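{- Let $p$ be a prime, $\ell\ge1$, let $R(Z)\in\mathbb F_p[Z]$ be a polynomial with $\deg R<\ell$, and let $m\in[-\ell,\ell]$ be an integer. Suppose that there exist monic coprime polynomials $F(Z),G(Z)\in\mathbb F_p[Z]$ satisfying $$G(0)\ne0,\qquad \deg F+\deg G\le\ell,\qquad \deg F-\deg G=m,\qquad \frac{F(Z)}{G(Z)}\bmod Z^\ell=R(Z).$$ Then $F$ and $G$ are uniquely determined by $(R,m)$. Moreover, there is an algorithm (D-RFR) that recovers $F$ and $G$ from $(R,m)$ in $O(\ell\log^2\ell)$ field operations.
   Context: For $F,G\in\mathbb F_p[Z]$ with $G(0)\neq0$, $\frac{F(Z)}{G(Z)}\bmod Z^\ell$ denotes the unique polynomial $R$ with $\deg R<\ell$ and $R(Z)G(Z)\equiv F(Z)\pmod{Z^\ell}$. Cost is counted in operations in $\mathbb F_p$, using standard fast polynomial arithmetic (polynomials of degree at most $n$ are multiplied in $O(n\log n)$ field operations). -}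

module Defs where

open import Algebra.Bundles.Raw using (RawRing)
open import Data.Bool using (Bool; if_then_else_)
open import Data.Fin using (Fin; toℕ; _≟_)
open import Data.Fin.Properties using (any?)
open import Data.Integer using (ℤ; +_)
open import Data.List using (List; []; _∷_; map)
open import Data.List.Relation.Unary.All using (all?)
open import Data.Nat using (ℕ; zero; suc; NonZero; _≤_; _<_)
open import Data.Nat.DivMod using (_mod_)
open import Data.Product using (_×_; _,_; ∃₂)
open import Data.Vec using (Vec; tabulate; toList)
open import Level using (0ℓ)
open import Relation.Binary.PropositionalEquality using (_≡_; _≢_)
open import Relation.Nullary using (yes; no; does)

import Algebra.Definitions.RawSemiring as RawSemiringDefinitions
import Data.Integer as ℤ
import Data.Nat as ℕ

-- A field only when p is prime.
𝔽 : ℕ → Set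
𝔽 p = Fin p

module _ {p : ℕ} .{{_ : NonZero p}} where

  infixl 6 _+ᶠ_ _-ᶠ_
  infixl 7 _*ᶠ_ _/ᶠ_

  0ᶠ 1ᶠ : 𝔽 p
  0ᶠ = 0 mod p
  1ᶠ = 1 mod p

  _+ᶠ_ _-ᶠ_ _*ᶠ_ _/ᶠ_ : 𝔽 p → 𝔽 p → 𝔽 p
  negᶠ invᶠ : 𝔽 p → 𝔽 p

  x +ᶠ y = (toℕ x ℕ.+ toℕ y) mod p
  x *ᶠ y = (toℕ x ℕ.* toℕ y) mod p
  negᶠ x = (p ℕ.∸ toℕ x) mod p
  x -ᶠ y = x +ᶠ negᶠ y

  -- Division is made total by setting x / 0 = 0.
  invᶠ x with any? (λ y → x *ᶠ y ≟ 1ᶠ)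
  ... | yes (y , _) = y
  ... | no  _       = 0ᶠ

  x /ᶠ y = x *ᶠ invᶠ y

-- Polynomials: coefficient lists, constant coefficient first. Trailing
-- zeros are allowed, so equality of polynomials is _≈_, not _≡_.
Poly : ℕ → Set
Poly p = List (𝔽 p)

module _ {p : ℕ} .{{_ : NonZero p}} where

  infix  4 _≈_
  infixl 6 _+ᴾ_
  infixl 7 _*ᴾ_
  infix  8 -ᴾ_

  coeff : Poly p → ℕ → 𝔽 p
  coeff []      i       = 0ᶠ
  coeff (a ∷ P) zero    = a
  coeff (a ∷ P) (suc i) = coeff P i

  _≈_ : Poly p → Poly p → Set
  P ≈ Q = ∀ i → coeff P i ≡ coeff Q i

  _+ᴾ_ _*ᴾ_ : Poly p → Poly p → Poly p
  []      +ᴾ Q       = Q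
  (a ∷ P) +ᴾ []      = a ∷ P
  (a ∷ P) +ᴾ (b ∷ Q) = (a +ᶠ b) ∷ (P +ᴾ Q)

  []      *ᴾ Q = []
  (a ∷ P) *ᴾ Q = map (a *ᶠ_) Q +ᴾ (0ᶠ ∷ P *ᴾ Q)

  -ᴾ_ : Poly p → Poly p
  -ᴾ P = map negᶠ P

  0ᴾ 1ᴾ Z : Poly p
  0ᴾ = []
  1ᴾ = 1ᶠ ∷ []
  Z  = 0ᶠ ∷ 1ᶠ ∷ []

  eval : Poly p → 𝔽 p → 𝔽 p
  eval []      x = 0ᶠ
  eval (a ∷ P) x = a +ᶠ x *ᶠ eval P x

  -- The zero polynomial gets degree 0 instead of -∞; for ℓ ≥ 1 this does
  -- not affect the meaning of deg R < ℓ.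
  deg : Poly p → ℕ
  deg []      = 0
  deg (a ∷ P) = if does (all? (_≟ 0ᶠ) P) then 0 else suc (deg P)

  Monic : Poly p → Set
  Monic P = coeff P (deg P) ≡ 1ᶠ

𝔽[Z] : (p : ℕ) .{{_ : NonZero p}} → RawRing 0ℓ 0ℓ
𝔽[Z] p = record
  { Carrier = Poly p
  ; _≈_     = _≈_
  ; _+_     = _+ᴾ_
  ; _*_     = _*ᴾ_
  ; -_      = -ᴾ_
  ; 0#      = 0ᴾ
  ; 1#      = 1ᴾ
  }

module _ {p : ℕ} .{{_ : NonZero p}} where

  open RawSemiringDefinitions (RawRing.rawSemiring (𝔽[Z] p)) public
    using (_∣_; Coprime; _^_)

  infix 4 _≈_[mod_]

  _≈_[mod_] : Poly p → Poly p → Poly p → Set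
  P ≈ Q [mod N ] = N ∣ (P +ᴾ (-ᴾ Q))

  -- "F / G mod Z^ℓ is R". For p prime, ℓ ≥ 1 and G(0) ≠ 0 there is exactly
  -- one such R up to _≈_.
  IsFractionMod : (F G : Poly p) (ℓ : ℕ) (R : Poly p) → Set
  IsFractionMod F G ℓ R = deg R < ℓ × (R *ᴾ G) ≈ F [mod Z ^ ℓ ]

  record IsReconstruction (ℓ : ℕ) (R : Poly p) (m : ℤ) (F G : Poly p) : Set where
    field
      monic-F    : Monic F
      monic-G    : Monic G
      coprime    : Coprime F G
      G[0]≢0     : eval G 0ᶠ ≢ 0ᶠ
      deg-sum    : deg F ℕ.+ deg G ≤ ℓ
      deg-diff   : (+ deg F) ℤ.- (+ deg G) ≡ m
      fraction   : IsFractionMod F G ℓ R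

data Op : Set where
  add sub mul div : Op

-- Programs with result in A that compute with field elements, represented
-- by the type X. `polyMul n` multiplies two polynomials of degree at most
-- n, given by their coefficient vectors.
data Program (X A : Set) : Set where
  return  : A → Program X A
  zero#   : (X → Program X A) → Program X A
  one#    : (X → Program X A) → Program X A
  op      : Op → X → X → (X → Program X A) → Program X A
  isZero? : X → (Bool → Program X A) → Program X A
  polyMul : (n : ℕ) → Vec X (suc n) → Vec X (suc n) →
            (Vec X (suc (n ℕ.+ n)) → Program X A) → Program X A

module _ {p : ℕ} .{{_ : NonZero p}} where

  ⟦_⟧ : Op → 𝔽 p → 𝔽 p → 𝔽 p
  ⟦ add ⟧ = _+ᶠ_
  ⟦ sub ⟧ = _-ᶠ_
  ⟦ mul ⟧ = _*ᶠ_
  ⟦ div ⟧ = _/ᶠ_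

  coefficients : (n : ℕ) → Poly p → Vec (𝔽 p) n
  coefficients n P = tabulate (λ i → coeff P (toℕ i))

  polyProduct : (n : ℕ) → (P Q : Vec (𝔽 p) (suc n)) → Vec (𝔽 p) (suc (n ℕ.+ n))
  polyProduct n P Q = coefficients (suc (n ℕ.+ n)) (toList P *ᴾ toList Q)

  run : {A : Set} → Program (𝔽 p) A → A
  run (return a)        = a
  run (zero# k)         = run (k 0ᶠ)
  run (one# k)          = run (k 1ᶠ)
  run (op o x y k)      = run (k (⟦ o ⟧ x y))
  run (isZero? x k)     = run (k (does (x ≟ 0ᶠ)))
  run (polyMul n P Q k) = run (k (polyProduct n P Q))

  -- The number of field operations performed when multiplying two
  -- polynomials of degree at most n takes M n of them.
  cost : (M : ℕ → ℕ) → {A : Set} → Program (𝔽 p) A → ℕ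
  cost M (return a)        = 0
  cost M (zero# k)         = 1 ℕ.+ cost M (k 0ᶠ)
  cost M (one# k)          = 1 ℕ.+ cost M (k 1ᶠ)
  cost M (op o x y k)      = 1 ℕ.+ cost M (k (⟦ o ⟧ x y))
  cost M (isZero? x k)     = 1 ℕ.+ cost M (k (does (x ≟ 0ᶠ)))
  cost M (polyMul n P Q k) = M n ℕ.+ cost M (k (polyProduct n P Q))

-- The input is ℓ, m and the coefficients of a polynomial of degree < ℓ, the
-- output two coefficient lists. An algorithm is a single function, uniform
-- in ℓ, m and the field; as it is polymorphic in X, it can obtain
-- information about field elements only through the instructions above.
-- Computations on ℓ, m and other indices are not field operations.
Algorithm : Set₁
Algorithm = {X : Set} (ℓ : ℕ) (m : ℤ) → Vec X ℓ → Program X (List X × List X)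

infix 4 _∈O[_]

_∈O[_] : (ℕ → ℕ) → (ℕ → ℕ) → Set
f ∈O[ g ] = ∃₂ λ c n₀ → ∀ n → n₀ ≤ n → f n ≤ c ℕ.* g n

{-# OPTIONS --safe #-}
module Submission where

-- For m ≥ 0 put k = G and h = F − Z^m G; for m < 0 put k = F and h = G − Z^(−m) F.
-- With n = |m|, the polynomial k is monic and coprime to h, deg h < deg k + n,
-- 2 deg k + n ≤ ℓ, and a k + b h ≡ 0 mod Z^ℓ for polynomials a, b that depend
-- only on R and m and do not both vanish at 0.
--
-- Starting from the rows (1, 0) and (0, 1), ℓ elementary steps yield a basis of
-- the solutions of this congruence that is reduced for the degree shifted by n:
-- each step eliminates the constant term of one residual by means of the other
-- row, which is then multiplied by Z. The 2×2 determinants formed by (k, h) and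
-- the two rows are divisible by Z^ℓ; comparing degrees, the one with the first row
-- vanishes, and coprimality forces the first row to be (k, h). In particular, any
-- two reconstructions agree.
--
-- A step reads only the constant terms of the residuals. Hence the first half of
-- the steps needs only the residuals modulo Z^(ℓ/2), after which the remaining
-- residuals are obtained by polynomial multiplication. On ℓ ≤ 2^h steps this
-- costs O(M(2^h)) in addition to two recursive calls with ℓ ≤ 2^(h−1).

open import Defs
open import Algebra.Bundles using (CommutativeMonoid; CommutativeRing; CommutativeSemiring)
open import Algebra.Definitions.RawMagma using (_,_)
open import Algebra.Structures using (IsCommutativeRing)
open import Data.Bool using (Bool; true; false; if_then_else_; not; _∧_; _∨_; T)
open import Data.Fin using (toℕ; _≟_)
open import Data.Fin.Properties using (any?; toℕ-fromℕ<; toℕ-injective; toℕ<n)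
open import Data.List using (List; []; _∷_; _++_; replicate; take; drop; length; applyUpTo; map)
open import Data.List.Properties using (length-take)
open import Data.List.Relation.Unary.All using (All; []; _∷_; all?)
open import Data.Nat using (zero; suc; z≤n; s≤s; s≤s⁻¹; _≤?_; _≤ᵇ_; ⌈_/2⌉; ⌊_/2⌋)
open import Data.Nat using (ℕ; NonZero; _≤_; _<_)
open import Data.Nat.Coprimality using (coprime-Bézout; prime⇒coprime)
open import Data.Nat.DivMod using (_%_; _mod_; m%n<n; m<n⇒m%n≡m; %-distribˡ-+; %-distribˡ-*; [m+n]%n≡m%n; [m+kn]%n≡m%n)
open import Data.Nat.GCD using (module Bézout)
open import Data.Nat.Logarithm using (⌈log₂_⌉; ⌈log₂⌉-mono-≤; ⌈log₂⌈n/2⌉⌉≡⌈log₂n⌉∸1; ⌈log₂2*n⌉≡1+⌈log₂n⌉; ⌈log₂2^n⌉≡n)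
open import Data.Nat.Primality using (Prime; prime⇒nonTrivial)
open import Data.Nat.Solver using (module +-*-Solver)
open import Data.Product using (_×_; _,_; Σ-syntax; proj₁; proj₂; ∃; ∃₂; swap)
open import Data.Sum using (_⊎_; inj₁; inj₂; map₁; map₂)
open import Data.Unit using (tt)
open import Data.Vec using (Vec; toList; tabulate) renaming ([] to []ᵛ; _∷_ to _∷ᵛ_)
open import Data.Vec.Properties using (length-toList)
open import Function using (_∘_; case_of_)
open import Level using (0ℓ)
open import Relation.Binary using (DecidableEquality)
open import Relation.Binary.PropositionalEquality hiding ([_])
open import Relation.Nullary using (Dec; yes; no; does; contradiction)

import Algebra.Properties.CommutativeSemigroup
import Algebra.Properties.Group
import Algebra.Properties.Ring
import Algebra.Solver.Ring.NaturalCoefficients.Default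
import Data.Integer as ℤ
import Data.Integer.Properties as ℤ
import Data.Nat as ℕ
import Data.Nat.Properties as ℕ

-- Arithmetic modulo p

-- The obstacle is the bound deg F + deg G ≤ ℓ, which also admits equality, whereas rational
-- reconstruction usually asks for deg F + deg G < ℓ. The prescribed degree difference makes up for
-- this: F and Z^m G (or G and Z^(-m) F) are monic of the same degree, so that forming h cancels the
-- leading terms and bounds deg h strictly. This leaves deg k + (deg k + n) ≤ ℓ unknown coefficients
-- against ℓ linear conditions. The strict bound enters twice: it keeps the determinant with the
-- second row monic, and it brings the degree of the determinant with the first row below ℓ. The
-- condition that a and b do not both vanish at 0 also has two uses. Some row always has a nonzero
-- constant residual, so that a next step exists; and a congruence multiplied by a or by b can be
-- cancelled. The diagonal entries of the basis stay monic throughout, so the first row is (k, h)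
-- itself and not just a scalar multiple of it.

module _ {p : ℕ} .{{_ : NonZero p}} where

  toℕ-mod : ∀ n → toℕ (n mod p) ≡ n % p
  toℕ-mod n = toℕ-fromℕ< (m%n<n n p)

  %≡⇒mod≡ : ∀ {m n} → m % p ≡ n % p → m mod p ≡ n mod p
  %≡⇒mod≡ {m} {n} eq = toℕ-injective (trans (toℕ-mod m) (trans eq (sym (toℕ-mod n))))

  mod-toℕ : (x : 𝔽 p) → toℕ x mod p ≡ x
  mod-toℕ x = toℕ-injective (trans (toℕ-mod (toℕ x)) (m<n⇒m%n≡m (toℕ<n x)))

  mod-+ : ∀ m n → (m mod p) +ᶠ (n mod p) ≡ (m ℕ.+ n) mod p
  mod-+ m n = trans (cong₂ (λ a b → (a ℕ.+ b) mod p) (toℕ-mod m) (toℕ-mod n))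
                    (%≡⇒mod≡ (sym (%-distribˡ-+ m n p)))

  mod-* : ∀ m n → (m mod p) *ᶠ (n mod p) ≡ (m ℕ.* n) mod p
  mod-* m n = trans (cong₂ (λ a b → (a ℕ.* b) mod p) (toℕ-mod m) (toℕ-mod n))
                    (%≡⇒mod≡ (sym (%-distribˡ-* m n p)))

  mod-+ˡ : ∀ m (x : 𝔽 p) → (m mod p) +ᶠ x ≡ (m ℕ.+ toℕ x) mod p
  mod-+ˡ m x = trans (cong (m mod p +ᶠ_) (sym (mod-toℕ x))) (mod-+ m (toℕ x))

  mod-*ˡ : ∀ m (x : 𝔽 p) → (m mod p) *ᶠ x ≡ (m ℕ.* toℕ x) mod p
  mod-*ˡ m x = trans (cong (m mod p *ᶠ_) (sym (mod-toℕ x))) (mod-* m (toℕ x))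

  +ᶠ-comm : (x y : 𝔽 p) → x +ᶠ y ≡ y +ᶠ x
  +ᶠ-comm x y = cong (_mod p) (ℕ.+-comm (toℕ x) (toℕ y))

  *ᶠ-comm : (x y : 𝔽 p) → x *ᶠ y ≡ y *ᶠ x
  *ᶠ-comm x y = cong (_mod p) (ℕ.*-comm (toℕ x) (toℕ y))

  +ᶠ-assoc : (x y z : 𝔽 p) → (x +ᶠ y) +ᶠ z ≡ x +ᶠ (y +ᶠ z)
  +ᶠ-assoc x y z = begin
    (x +ᶠ y) +ᶠ z                          ≡⟨ mod-+ˡ _ z ⟩
    (toℕ x ℕ.+ toℕ y ℕ.+ toℕ z) mod p      ≡⟨ cong (_mod p) (ℕ.+-assoc (toℕ x) (toℕ y) (toℕ z)) ⟩
    (toℕ x ℕ.+ (toℕ y ℕ.+ toℕ z)) mod p    ≡⟨ cong (_mod p) (ℕ.+-comm (toℕ x) _) ⟩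
    ((toℕ y ℕ.+ toℕ z) ℕ.+ toℕ x) mod p    ≡⟨ mod-+ˡ _ x ⟨
    (y +ᶠ z) +ᶠ x                          ≡⟨ +ᶠ-comm _ x ⟩
    x +ᶠ (y +ᶠ z)                          ∎
    where open ≡-Reasoning

  *ᶠ-assoc : (x y z : 𝔽 p) → (x *ᶠ y) *ᶠ z ≡ x *ᶠ (y *ᶠ z)
  *ᶠ-assoc x y z = begin
    (x *ᶠ y) *ᶠ z                          ≡⟨ mod-*ˡ _ z ⟩
    (toℕ x ℕ.* toℕ y ℕ.* toℕ z) mod p      ≡⟨ cong (_mod p) (ℕ.*-assoc (toℕ x) (toℕ y) (toℕ z)) ⟩
    (toℕ x ℕ.* (toℕ y ℕ.* toℕ z)) mod p    ≡⟨ cong (_mod p) (ℕ.*-comm (toℕ x) _) ⟩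
    ((toℕ y ℕ.* toℕ z) ℕ.* toℕ x) mod p    ≡⟨ mod-*ˡ _ x ⟨
    (y *ᶠ z) *ᶠ x                          ≡⟨ *ᶠ-comm _ x ⟩
    x *ᶠ (y *ᶠ z)                          ∎
    where open ≡-Reasoning

  *ᶠ-distribʳ : (x y z : 𝔽 p) → (y +ᶠ z) *ᶠ x ≡ y *ᶠ x +ᶠ z *ᶠ x
  *ᶠ-distribʳ x y z = begin
    (y +ᶠ z) *ᶠ x                                   ≡⟨ mod-*ˡ _ x ⟩
    ((toℕ y ℕ.+ toℕ z) ℕ.* toℕ x) mod p             ≡⟨ cong (_mod p) (ℕ.*-distribʳ-+ (toℕ x) (toℕ y) (toℕ z)) ⟩
    (toℕ y ℕ.* toℕ x ℕ.+ toℕ z ℕ.* toℕ x) mod p     ≡⟨ mod-+ _ _ ⟨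
    y *ᶠ x +ᶠ z *ᶠ x                                ∎
    where open ≡-Reasoning

  *ᶠ-distribˡ : (x y z : 𝔽 p) → x *ᶠ (y +ᶠ z) ≡ x *ᶠ y +ᶠ x *ᶠ z
  *ᶠ-distribˡ x y z = trans (*ᶠ-comm x _)
    (trans (*ᶠ-distribʳ x y z) (cong₂ _+ᶠ_ (*ᶠ-comm y x) (*ᶠ-comm z x)))

  +ᶠ-identityˡ : (x : 𝔽 p) → 0ᶠ +ᶠ x ≡ x
  +ᶠ-identityˡ x = trans (mod-+ˡ 0 x) (mod-toℕ x)

  *ᶠ-identityˡ : (x : 𝔽 p) → 1ᶠ *ᶠ x ≡ x
  *ᶠ-identityˡ x = trans (mod-*ˡ 1 x) (trans (cong (_mod p) (ℕ.*-identityˡ (toℕ x))) (mod-toℕ x))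

  negᶠ-inverseˡ : (x : 𝔽 p) → negᶠ x +ᶠ x ≡ 0ᶠ
  negᶠ-inverseˡ x = begin
    negᶠ x +ᶠ x                        ≡⟨ mod-+ˡ _ x ⟩
    ((p ℕ.∸ toℕ x) ℕ.+ toℕ x) mod p    ≡⟨ cong (_mod p) (ℕ.m∸n+n≡m (ℕ.<⇒≤ (toℕ<n x))) ⟩
    p mod p                            ≡⟨ %≡⇒mod≡ ([m+n]%n≡m%n 0 p) ⟩
    0ᶠ                                 ∎
    where open ≡-Reasoning

  𝔽-isCommutativeRing : IsCommutativeRing _≡_ (_+ᶠ_ {p}) _*ᶠ_ negᶠ 0ᶠ 1ᶠ
  𝔽-isCommutativeRing = record
    { isRing = record
      { +-isAbelianGroup = record
        { isGroup = record
          { isMonoid = record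
            { isSemigroup = record
              { isMagma = record { isEquivalence = isEquivalence ; ∙-cong = cong₂ _+ᶠ_ }
              ; assoc = +ᶠ-assoc
              }
            ; identity = +ᶠ-identityˡ , λ x → trans (+ᶠ-comm x _) (+ᶠ-identityˡ x)
            }
          ; inverse = negᶠ-inverseˡ , λ x → trans (+ᶠ-comm x _) (negᶠ-inverseˡ x)
          ; ⁻¹-cong = cong negᶠ
          }
        ; comm = +ᶠ-comm
        }
      ; *-cong = cong₂ _*ᶠ_
      ; *-assoc = *ᶠ-assoc
      ; *-identity = *ᶠ-identityˡ , λ x → trans (*ᶠ-comm x _) (*ᶠ-identityˡ x)
      ; distrib = *ᶠ-distribˡ , *ᶠ-distribʳ
      }
    ; *-comm = *ᶠ-comm
    }

𝔽-commutativeRing : (p : ℕ) .{{_ : NonZero p}} → CommutativeRing 0ℓ 0ℓ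
𝔽-commutativeRing p = record { isCommutativeRing = 𝔽-isCommutativeRing {p} }

module _ {p : ℕ} .{{_ : NonZero p}} (p-prime : Prime p) where

  ∃-inverse : (x : 𝔽 p) → x ≢ 0ᶠ → ∃ λ y → x *ᶠ y ≡ 1ᶠ
  ∃-inverse x x≢0 with coprime-Bézout (prime⇒coprime p-prime {{x-nonZero}} (toℕ<n x))
    where
    x-nonZero : NonZero (toℕ x)
    x-nonZero = ℕ.≢-nonZero λ x≡0 → x≢0 (trans (sym (mod-toℕ x)) (cong (_mod p) x≡0))
  ... | Bézout.-+ a b eq = b mod p , (begin
    x *ᶠ (b mod p)                   ≡⟨ *ᶠ-comm x _ ⟩
    (b mod p) *ᶠ x                   ≡⟨ mod-*ˡ b x ⟩
    (b ℕ.* toℕ x) mod p              ≡⟨ cong (_mod p) eq ⟨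
    (1 ℕ.+ a ℕ.* p) mod p            ≡⟨ %≡⇒mod≡ ([m+kn]%n≡m%n 1 a p) ⟩
    1ᶠ                               ∎)
    where open ≡-Reasoning
  -- Bézout's identity over the natural numbers has two sign patterns. In this one `1 + b x = a p`,
  -- so the inverse is `- b`.
  ... | Bézout.+- a b eq = negᶠ (b mod p) , (begin
    x *ᶠ negᶠ (b mod p)              ≡⟨ -‿distribʳ-* x (b mod p) ⟨
    negᶠ (x *ᶠ (b mod p))            ≡⟨ inverseˡ-unique _ _ 1+xb≡0 ⟨
    1ᶠ                               ∎)
    where
    open Algebra.Properties.Ring (CommutativeRing.ring (𝔽-commutativeRing p))
    open Algebra.Properties.Group (CommutativeRing.+-group (𝔽-commutativeRing p))
    open ≡-Reasoning
    1+xb≡0 : 1ᶠ +ᶠ x *ᶠ (b mod p) ≡ 0ᶠ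
    1+xb≡0 = begin
      1ᶠ +ᶠ x *ᶠ (b mod p)           ≡⟨ cong (1ᶠ +ᶠ_) (trans (*ᶠ-comm x _) (mod-*ˡ b x)) ⟩
      1ᶠ +ᶠ (b ℕ.* toℕ x) mod p      ≡⟨ mod-+ 1 _ ⟩
      (1 ℕ.+ b ℕ.* toℕ x) mod p      ≡⟨ cong (_mod p) eq ⟩
      (a ℕ.* p) mod p                ≡⟨ %≡⇒mod≡ ([m+kn]%n≡m%n 0 a p) ⟩
      0ᶠ                             ∎

  *ᶠ-inverseʳ : (x : 𝔽 p) → x ≢ 0ᶠ → x *ᶠ invᶠ x ≡ 1ᶠ
  *ᶠ-inverseʳ x x≢0 with any? (λ y → x *ᶠ y ≟ 1ᶠ)
  ... | yes (y , xy≡1) = xy≡1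
  ... | no  ∄y         = contradiction (∃-inverse x x≢0) ∄y

  1≢0 : 1ᶠ {p} ≢ 0ᶠ
  1≢0 1≡0 = contradiction (trans (sym 1%p≡1) (trans (sym (toℕ-mod 1)) (trans (cong toℕ 1≡0) (trans (toℕ-mod 0) (m<n⇒m%n≡m 0<p))))) λ ()
    where
    0<p : 0 ℕ.< p
    0<p = ℕ.<-trans (ℕ.s≤s ℕ.z≤n) (ℕ.nonTrivial⇒n>1 p {{prime⇒nonTrivial p-prime}})
    1%p≡1 : 1 % p ≡ 1
    1%p≡1 = m<n⇒m%n≡m (ℕ.nonTrivial⇒n>1 p {{prime⇒nonTrivial p-prime}})

-- Power series

module PowerSeries {A : Set} {plus times : A → A → A} {negate : A → A} {zero# one# : A}
  (isCommutativeRing : IsCommutativeRing _≡_ plus times negate zero# one#) where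

  private
    coefficientRing : CommutativeRing 0ℓ 0ℓ
    coefficientRing = record { isCommutativeRing = isCommutativeRing }

    module C = CommutativeRing coefficientRing
    open Algebra.Properties.CommutativeSemigroup
      (CommutativeMonoid.commutativeSemigroup C.+-commutativeMonoid)
      using (interchange)
    open Algebra.Properties.Ring C.ring using (-0#≈0#)
    open C using (_+_; _*_; -_; 0#; 1#)

  open ≡-Reasoning

  -- Polynomials are treated as series that vanish from some index on. This removes trailing zeros
  -- from the discussion and makes congruence modulo Z^k mere agreement below k.
  Series : Set
  Series = ℕ → A

  infixl 6 _⊕_ _⊖_
  infixl 7 _⊛_ _·_

  _⊕_ _⊖_ _⊛_ : Series → Series → Series
  (f ⊕ g) i = f i + g i
  (f ⊖ g) i = f i + (- g i)
  (f ⊛ g) zero    = f 0 * g 0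
  (f ⊛ g) (suc i) = f 0 * g (suc i) + (f ∘ suc ⊛ g) i

  _·_ : A → Series → Series
  (a · f) i = a * f i

  ⊝_ : Series → Series
  (⊝ f) i = - f i

  0ˢ 1ˢ : Series
  0ˢ _ = 0#
  1ˢ zero    = 1#
  1ˢ (suc _) = 0#

  infixr 5 _◂_

  _◂_ : A → Series → Series
  (a ◂ f) zero    = a
  (a ◂ f) (suc i) = f i

  infix 4 _≈[_]_

  _≈[_]_ : Series → ℕ → Series → Set
  f ≈[ k ] g = ∀ {i} → i < k → f i ≡ g i

  ⊛-cong[] : ∀ {k f f′ g g′} → f ≈[ k ] f′ → g ≈[ k ] g′ → f ⊛ g ≈[ k ] f′ ⊛ g′
  ⊛-cong[] {suc k} f≈f′ g≈g′ {zero}  0<k = cong₂ _*_ (f≈f′ 0<k) (g≈g′ 0<k)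
  ⊛-cong[] {suc k} f≈f′ g≈g′ {suc i} i<k = cong₂ _+_
    (cong₂ _*_ (f≈f′ (s≤s z≤n)) (g≈g′ i<k))
    (⊛-cong[] (f≈f′ ∘ s≤s) (g≈g′ ∘ ℕ.m<n⇒m<1+n) (s≤s⁻¹ i<k))

  ⊛-cong : ∀ {f f′ g g′} → f ≗ f′ → g ≗ g′ → f ⊛ g ≗ f′ ⊛ g′
  ⊛-cong f≗f′ g≗g′ i = ⊛-cong[] {suc i} (λ _ → f≗f′ _) (λ _ → g≗g′ _) ℕ.≤-refl

  ⊛-congˡ : ∀ {f g g′} → g ≗ g′ → f ⊛ g ≗ f ⊛ g′
  ⊛-congˡ {f} = ⊛-cong {f} (λ _ → refl)

  ⊛-congʳ : ∀ {f f′ g} → f ≗ f′ → f ⊛ g ≗ f′ ⊛ g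
  ⊛-congʳ f≗f′ = ⊛-cong f≗f′ (λ _ → refl)

  ⊛-zeroˡ : ∀ g → 0ˢ ⊛ g ≗ 0ˢ
  ⊛-zeroˡ g zero    = C.zeroˡ _
  ⊛-zeroˡ g (suc i) = trans (cong₂ _+_ (C.zeroˡ _) (⊛-zeroˡ g i)) (C.+-identityʳ 0#)

  constant-⊛ : ∀ {f} g → f ∘ suc ≗ 0ˢ → f ⊛ g ≗ f 0 · g
  constant-⊛ g f≗f₀ zero    = refl
  constant-⊛ g f≗f₀ (suc i) =
    trans (C.+-congˡ (trans (⊛-congʳ f≗f₀ i) (⊛-zeroˡ g i))) (C.+-identityʳ _)

  ⊛-identityˡ : ∀ f → 1ˢ ⊛ f ≗ f
  ⊛-identityˡ f i = trans (constant-⊛ {1ˢ} f (λ _ → refl) i) (C.*-identityˡ _)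

  -- The Cauchy sum is peeled at its other end. The product recurses on its left factor only, so
  -- commutativity needs this second recursion.
  ⊛-sucʳ : ∀ f g i → (f ⊛ g) (suc i) ≡ (f ⊛ g ∘ suc) i + f (suc i) * g 0
  ⊛-sucʳ f g zero    = refl
  ⊛-sucʳ f g (suc i) = trans (C.+-congˡ (⊛-sucʳ (f ∘ suc) g i)) (sym (C.+-assoc _ _ _))

  ⊛-comm : ∀ f g → f ⊛ g ≗ g ⊛ f
  ⊛-comm f g zero    = C.*-comm _ _
  ⊛-comm f g (suc i) = begin
    f 0 * g (suc i) + (f ∘ suc ⊛ g) i  ≡⟨ cong₂ _+_ (C.*-comm _ _) (⊛-comm (f ∘ suc) g i) ⟩
    g (suc i) * f 0 + (g ⊛ f ∘ suc) i  ≡⟨ C.+-comm _ _ ⟩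
    (g ⊛ f ∘ suc) i + g (suc i) * f 0  ≡⟨ ⊛-sucʳ g f i ⟨
    (g ⊛ f) (suc i)                    ∎

  ⊛-distribʳ : ∀ h f g → (f ⊕ g) ⊛ h ≗ f ⊛ h ⊕ g ⊛ h
  ⊛-distribʳ h f g zero    = C.distribʳ _ _ _
  ⊛-distribʳ h f g (suc i) = trans
    (cong₂ _+_ (C.distribʳ _ _ _) (⊛-distribʳ h (f ∘ suc) (g ∘ suc) i)) (interchange _ _ _ _)

  ·-⊛ : ∀ a f g → (a · f) ⊛ g ≗ a · (f ⊛ g)
  ·-⊛ a f g zero    = C.*-assoc _ _ _
  ·-⊛ a f g (suc i) = trans
    (cong₂ _+_ (C.*-assoc _ _ _) (·-⊛ a (f ∘ suc) g i)) (sym (C.distribˡ _ _ _))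

  ⊛-assoc : ∀ f g h → (f ⊛ g) ⊛ h ≗ f ⊛ (g ⊛ h)
  ⊛-assoc f g h zero    = C.*-assoc _ _ _
  ⊛-assoc f g h (suc i) = begin
    f 0 * g 0 * h (suc i) + ((f 0 · (g ∘ suc) ⊕ f ∘ suc ⊛ g) ⊛ h) i
      ≡⟨ cong₂ _+_ (C.*-assoc _ _ _) (⊛-distribʳ h (f 0 · (g ∘ suc)) (f ∘ suc ⊛ g) i) ⟩
    f 0 * (g 0 * h (suc i)) + ((f 0 · (g ∘ suc) ⊛ h) i + ((f ∘ suc ⊛ g) ⊛ h) i)
      ≡⟨ C.+-congˡ (cong₂ _+_ (·-⊛ (f 0) (g ∘ suc) h i) (⊛-assoc (f ∘ suc) g h i)) ⟩
    f 0 * (g 0 * h (suc i)) + (f 0 * (g ∘ suc ⊛ h) i + (f ∘ suc ⊛ (g ⊛ h)) i)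
      ≡⟨ C.+-assoc _ _ _ ⟨
    f 0 * (g 0 * h (suc i)) + f 0 * (g ∘ suc ⊛ h) i + (f ∘ suc ⊛ (g ⊛ h)) i
      ≡⟨ C.+-congʳ (C.distribˡ _ _ _) ⟨
    f 0 * (g ⊛ h) (suc i) + (f ∘ suc ⊛ (g ⊛ h)) i ∎

  seriesRing : CommutativeRing 0ℓ 0ℓ
  seriesRing = record
    { Carrier = Series
    ; _≈_ = _≗_
    ; _+_ = _⊕_
    ; _*_ = _⊛_
    ; -_  = ⊝_
    ; 0#  = 0ˢ
    ; 1#  = 1ˢ
    ; isCommutativeRing = record
      { isRing = record
        { +-isAbelianGroup = record
          { isGroup = record
            { isMonoid = record
              { isSemigroup = record
                { isMagma = record
                  { isEquivalence = record
                    { refl  = λ _ → refl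
                    ; sym   = λ f≗g i → sym (f≗g i)
                    ; trans = λ f≗g g≗h i → trans (f≗g i) (g≗h i)
                    }
                  ; ∙-cong = λ f≗f′ g≗g′ i → cong₂ _+_ (f≗f′ i) (g≗g′ i)
                  }
                ; assoc = λ _ _ _ _ → C.+-assoc _ _ _
                }
              ; identity = (λ _ _ → C.+-identityˡ _) , (λ _ _ → C.+-identityʳ _)
              }
            ; inverse = (λ _ _ → C.-‿inverseˡ _) , (λ _ _ → C.-‿inverseʳ _)
            ; ⁻¹-cong = λ f≗g i → cong -_ (f≗g i)
            }
          ; comm = λ _ _ _ → C.+-comm _ _
          }
        ; *-cong = ⊛-cong
        ; *-assoc = ⊛-assoc
        ; *-identity = ⊛-identityˡ , λ f i → trans (⊛-comm f 1ˢ i) (⊛-identityˡ f i)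
        ; distrib = (λ f g h i → trans (⊛-comm f (g ⊕ h) i) (trans (⊛-distribʳ f g h i)
                                   (cong₂ _+_ (⊛-comm g f i) (⊛-comm h f i))))
                  , ⊛-distribʳ
        }
      ; *-comm = ⊛-comm
      }
    }

  module S = CommutativeRing seriesRing

  shift : ℕ → Series → Series
  shift zero    f = f
  shift (suc k) f = 0# ◂ shift k f

  shift-< : ∀ k f → shift k f ≈[ k ] 0ˢ
  shift-< (suc k) f {zero}  _   = refl
  shift-< (suc k) f {suc i} i<k = shift-< k f (s≤s⁻¹ i<k)

  shift-+ : ∀ k f i → shift k f (k ℕ.+ i) ≡ f i
  shift-+ zero    f i = refl
  shift-+ (suc k) f i = shift-+ k f i

  0◂-⊛ : ∀ f g → (0# ◂ f) ⊛ g ≗ 0# ◂ (f ⊛ g)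
  0◂-⊛ f g zero    = C.zeroˡ _
  0◂-⊛ f g (suc i) = trans (C.+-congʳ (C.zeroˡ _)) (C.+-identityˡ _)

  ◂-cong : ∀ {a f g} → f ≗ g → a ◂ f ≗ a ◂ g
  ◂-cong f≗g zero    = refl
  ◂-cong f≗g (suc i) = f≗g i

  shift-⊛ : ∀ k f g → shift k f ⊛ g ≗ shift k (f ⊛ g)
  shift-⊛ zero    f g = λ _ → refl
  shift-⊛ (suc k) f g = S.trans (0◂-⊛ (shift k f) g) (◂-cong (shift-⊛ k f g))

  shift-cong : ∀ k {f g} → f ≗ g → shift k f ≗ shift k g
  shift-cong zero    f≗g = f≗g
  shift-cong (suc k) f≗g = ◂-cong (shift-cong k f≗g)

  ⊛-shift : ∀ k f g → f ⊛ shift k g ≗ shift k (f ⊛ g)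
  ⊛-shift k f g = S.trans (⊛-comm f (shift k g)) (S.trans (shift-⊛ k g f) (shift-cong k (⊛-comm g f)))

  shift-⊕ : ∀ k f g → shift k (f ⊕ g) ≗ shift k f ⊕ shift k g
  shift-⊕ zero    f g i       = refl
  shift-⊕ (suc k) f g zero    = sym (C.+-identityˡ 0#)
  shift-⊕ (suc k) f g (suc i) = shift-⊕ k f g i

  shift-≗ : ∀ k f → f ≈[ k ] 0ˢ → shift k (λ i → f (k ℕ.+ i)) ≗ f
  shift-≗ zero    f _    i       = refl
  shift-≗ (suc k) f f≈0 zero    = sym (f≈0 (s≤s z≤n))
  shift-≗ (suc k) f f≈0 (suc i) = shift-≗ k (f ∘ suc) (f≈0 ∘ s≤s) i

  -- Degree bounds and leading coefficients

  infix 5 deg<_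

  deg<_ : ℕ → Series → Set
  (deg< d) f = ∀ i → d ≤ i → f i ≡ 0#

  MonicAt : ℕ → Series → Set
  MonicAt d f = f d ≡ 1# × (deg< suc d) f

  Finite : Series → Set
  Finite f = ∃ λ d → (deg< d) f

  deg<-mono : ∀ {d e f} → d ≤ e → (deg< d) f → (deg< e) f
  deg<-mono d≤e f<d i e≤i = f<d i (ℕ.≤-trans d≤e e≤i)

  -- One bound is strict and the other is not, so the degrees add without a predecessor; `d = 0`
  -- covers the zero series.
  deg<-⊛ : ∀ d e {f g} → (deg< d) f → (deg< suc e) g → (deg< d ℕ.+ e) (f ⊛ g)
  deg<-⊛ zero    e {f} {g} f<d g≤e i       _   = trans (⊛-congʳ {f} (λ j → f<d j z≤n) i) (⊛-zeroˡ g i)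
  deg<-⊛ (suc d) e {f} {g} f<d g≤e (suc i) d+e≤i = begin
    f 0 * g (suc i) + (f ∘ suc ⊛ g) i  ≡⟨ cong₂ _+_ (C.*-congˡ (g≤e (suc i) (s≤s (ℕ.m+n≤o⇒n≤o d (s≤s⁻¹ d+e≤i)))))
                                            (deg<-⊛ d e (λ j d≤j → f<d (suc j) (s≤s d≤j)) g≤e i (s≤s⁻¹ d+e≤i)) ⟩
    f 0 * 0# + 0#                      ≡⟨ trans (C.+-identityʳ _) (C.zeroʳ _) ⟩
    0#                                 ∎

  leading-⊛ : ∀ d e {f g} → (deg< suc d) f → (deg< suc e) g → (f ⊛ g) (d ℕ.+ e) ≡ f d * g e
  leading-⊛ zero    e {f} {g} f≤d g≤e = constant-⊛ {f} g (λ i → f≤d (suc i) (s≤s z≤n)) e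
  leading-⊛ (suc d) e {f} {g} f≤d g≤e = begin
    f 0 * g (suc (d ℕ.+ e)) + (f ∘ suc ⊛ g) (d ℕ.+ e)  ≡⟨ cong₂ _+_ (C.*-congˡ (g≤e (suc (d ℕ.+ e)) (s≤s (ℕ.m≤n+m e d))))
                                                           (leading-⊛ d e (λ j d≤j → f≤d (suc j) (s≤s d≤j)) g≤e) ⟩
    f 0 * 0# + f (suc d) * g e                        ≡⟨ trans (C.+-congʳ (C.zeroʳ _)) (C.+-identityˡ _) ⟩
    f (suc d) * g e                                   ∎

  deg<-⊕ : ∀ {d f g} → (deg< d) f → (deg< d) g → (deg< d) (f ⊕ g)
  deg<-⊕ f<d g<d i d≤i = trans (cong₂ _+_ (f<d i d≤i) (g<d i d≤i)) (C.+-identityʳ 0#)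

  deg<-⊖ : ∀ {d f g} → (deg< d) f → (deg< d) g → (deg< d) (f ⊖ g)
  deg<-⊖ f<d g<d = deg<-⊕ f<d (λ i d≤i → trans (cong -_ (g<d i d≤i)) -0#≈0#)

  deg<-shift : ∀ k {d f} → (deg< d) f → (deg< k ℕ.+ d) (shift k f)
  deg<-shift zero    f<d = f<d
  deg<-shift (suc k) f<d (suc i) k+d≤i = deg<-shift k f<d i (s≤s⁻¹ k+d≤i)

  deg<-unshift : ∀ k {d f} → (deg< k ℕ.+ d) (shift k f) → (deg< d) f
  deg<-unshift k {d} {f} Zf<k+d i d≤i =
    trans (sym (shift-+ k f i)) (Zf<k+d (k ℕ.+ i) (ℕ.+-monoʳ-≤ k d≤i))

  deg<-≗ : ∀ {d f g} → f ≗ g → (deg< d) f → (deg< d) g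
  deg<-≗ f≗g f<d i d≤i = trans (sym (f≗g i)) (f<d i d≤i)

  -- A nonzero f would put its leading coefficient into the product at index deg f + k, because g is
  -- monic. The induction removes the possible degrees of f from the top.
  monic-⊛-deg< : ∀ d {k f g} → MonicAt k g → (deg< d) f → (deg< k) (f ⊛ g) → f ≗ 0ˢ
  monic-⊛-deg< zero        _                  f<d fg<k i = f<d i z≤n
  monic-⊛-deg< (suc d) {k} {f} {g} g-monic@(gₖ≡1 , g≤k) f≤d fg<k = monic-⊛-deg< d g-monic f<d fg<k
    where
    f<d : (deg< d) f
    f<d i d≤i with ℕ.m≤n⇒m<n∨m≡n d≤i
    ... | inj₁ d<i  = f≤d i d<i
    ... | inj₂ refl = begin
      f d                 ≡⟨ C.*-identityʳ _ ⟨
      f d * 1#            ≡⟨ cong (f d *_) gₖ≡1 ⟨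
      f d * g k           ≡⟨ leading-⊛ d k f≤d g≤k ⟨
      (f ⊛ g) (d ℕ.+ k)   ≡⟨ fg<k _ (ℕ.m≤n+m k d) ⟩
      0#                  ∎

-- Identities without subtraction, with negative terms moved to the other side

module Identities (R : CommutativeSemiring 0ℓ 0ℓ) where

  open CommutativeSemiring R renaming (refl to ≈-refl; _≈_ to infix 4 _≈ᴿ_)
  open Algebra.Solver.Ring.NaturalCoefficients.Default R

  cross₁ : ∀ a b k h u v → a * (k * v) + h * (a * u + b * v) ≈ᴿ a * (h * u) + v * (a * k + b * h)
  cross₁ = solve 6 (λ a b k h u v →
    a :* (k :* v) :+ h :* (a :* u :+ b :* v) := a :* (h :* u) :+ v :* (a :* k :+ b :* h)) ≈-refl

  cross₂ : ∀ a b k h u v → b * (k * v) + u * (a * k + b * h) ≈ᴿ b * (h * u) + k * (a * u + b * v)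
  cross₂ = solve 6 (λ a b k h u v →
    b :* (k :* v) :+ u :* (a :* k :+ b :* h) := b :* (h :* u) :+ k :* (a :* u :+ b :* v)) ≈-refl

  row-assoc : ∀ p q a b c d x y →
    (p * a + q * c) * x + (p * b + q * d) * y ≈ᴿ p * (a * x + b * y) + q * (c * x + d * y)
  row-assoc = solve 8 (λ p q a b c d x y →
    (p :* a :+ q :* c) :* x :+ (p :* b :+ q :* d) :* y :=
    p :* (a :* x :+ b :* y) :+ q :* (c :* x :+ d :* y)) ≈-refl

  expandˡ : ∀ k x q y → k * (x + q * y) ≈ᴿ k * x + q * (k * y)
  expandˡ = solve 4 (λ k x q y → k :* (x :+ q :* y) := k :* x :+ q :* (k :* y)) ≈-refl

  expandʳ : ∀ h q w r → (q * w + r) * h ≈ᴿ h * r + q * (h * w)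
  expandʳ = solve 4 (λ h q w r → (q :* w :+ r) :* h := h :* r :+ q :* (h :* w)) ≈-refl

record Matrix (X : Set) : Set where
  constructor matrix
  field
    ₁₁ ₁₂ ₂₁ ₂₂ : X

module OrderBasis {A : Set} {plus times : A → A → A} {negate : A → A} {zero# one# : A}
  (isCommutativeRing : IsCommutativeRing _≡_ plus times negate zero# one#)
  (_≟_ : DecidableEquality A)
  (1≢0 : one# ≢ zero#)
  (inverse : ∀ x → x ≢ zero# → ∃ λ y → times x y ≡ one#)
  where

  open Matrix
  open PowerSeries isCommutativeRing
  open ≡-Reasoning

  private
    coefficientRing : CommutativeRing 0ℓ 0ℓ
    coefficientRing = record { isCommutativeRing = isCommutativeRing }

    module C = CommutativeRing coefficientRing
    open C using (_+_; _*_; -_; 0#; 1#)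
    open Algebra.Properties.Group C.+-group using () renaming (∙-cancelʳ to +-cancelʳ; x∙y⁻¹≈ε⇒x≈y to x-y≡0⇒x≡y)
    open Algebra.Properties.Ring C.ring using (-0#≈0#; -1*x≈-x; -‿distribˡ-*)
    open Algebra.Properties.Ring S.ring using () renaming (-‿distribʳ-* to -‿distribʳ-⊛)
    open Identities S.commutativeSemiring

  -- Cancellation, division with remainder and reduced fractions

  x-y+y≡x : ∀ x y → x + (- y) + y ≡ x
  x-y+y≡x x y = trans (C.+-assoc x (- y) y) (trans (C.+-congˡ (C.-‿inverseˡ y)) (C.+-identityʳ x))

  *-cancelˡ-≢0 : ∀ {a x y} → a ≢ 0# → a * x ≡ a * y → x ≡ y
  *-cancelˡ-≢0 {a} {x} {y} a≢0 ax≡ay with inverse a a≢0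
  ... | b , ab≡1 = begin
    x            ≡⟨ b[az]≡z x ⟨
    b * (a * x)  ≡⟨ cong (b *_) ax≡ay ⟩
    b * (a * y)  ≡⟨ b[az]≡z y ⟩
    y            ∎
    where
    b[az]≡z : ∀ z → b * (a * z) ≡ z
    b[az]≡z z = trans (sym (C.*-assoc b a z))
      (trans (C.*-congʳ (trans (C.*-comm b a) ab≡1)) (C.*-identityˡ z))

  -- A series with nonzero constant term is a unit. Coefficient j of the product is b(0) f(j) plus
  -- terms in earlier coefficients of f, so cancellation proceeds index by index and no inverse
  -- series is built.
  ⊛-cancelˡ-[] : ∀ k {b f g} → b 0 ≢ 0# → b ⊛ f ≈[ k ] b ⊛ g → f ≈[ k ] g
  ⊛-cancelˡ-[] (suc k) {b} {f} {g} b₀≢0 bf≈bg {i} i<1+k with ℕ.m<1+n⇒m<n∨m≡n i<1+k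
  ... | inj₁ i<k  = ⊛-cancelˡ-[] k b₀≢0 (bf≈bg ∘ ℕ.m<n⇒m<1+n) i<k
  ... | inj₂ refl = last i (⊛-cancelˡ-[] k b₀≢0 (bf≈bg ∘ ℕ.m<n⇒m<1+n)) (bf≈bg i<1+k)
    where
    last : ∀ j → f ≈[ j ] g → (b ⊛ f) j ≡ (b ⊛ g) j → f j ≡ g j
    last zero    _   eq = *-cancelˡ-≢0 b₀≢0 eq
    last (suc j) f≈g eq = *-cancelˡ-≢0 b₀≢0 (+-cancelʳ _ _ _
      (trans eq (C.+-congˡ (sym (⊛-cong[] {f = b ∘ suc} (λ _ → refl) f≈g ℕ.≤-refl)))))

  Unimodular : Series → Series → Set
  Unimodular a b = a 0 ≢ 0# ⊎ b 0 ≢ 0#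

  ⊛-≈0 : ∀ {k} f {g} → g ≈[ k ] 0ˢ → f ⊛ g ≈[ k ] 0ˢ
  ⊛-≈0 f g≈0 {i} i<k = trans (⊛-cong[] {f = f} (λ _ → refl) g≈0 i<k) (S.zeroʳ f i)

  -- Cramer's rule: a (k v - h u) = v (a k + b h) - h (a u + b v), and similarly for b. Whichever of
  -- a and b is a unit modulo Z^ℓ is cancelled.
  cross : ∀ {ℓ a b k h u v} → Unimodular a b →
          a ⊛ k ⊕ b ⊛ h ≈[ ℓ ] 0ˢ → a ⊛ u ⊕ b ⊛ v ≈[ ℓ ] 0ˢ → k ⊛ v ≈[ ℓ ] h ⊛ u
  cross {ℓ} {a} {b} {k} {h} {u} {v} unimodular kh≈0 uv≈0 with unimodular
  ... | inj₁ a₀≢0 = ⊛-cancelˡ-[] ℓ a₀≢0 λ {i} i<ℓ → begin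
    (a ⊛ (k ⊛ v)) i                                ≡⟨ +0 (⊛-≈0 h uv≈0 i<ℓ) ⟨
    (a ⊛ (k ⊛ v)) i + (h ⊛ (a ⊛ u ⊕ b ⊛ v)) i      ≡⟨ cross₁ a b k h u v i ⟩
    (a ⊛ (h ⊛ u)) i + (v ⊛ (a ⊛ k ⊕ b ⊛ h)) i      ≡⟨ +0 (⊛-≈0 v kh≈0 i<ℓ) ⟩
    (a ⊛ (h ⊛ u)) i                                ∎
    where
    +0 : ∀ {x y} → y ≡ 0# → x + y ≡ x
    +0 y≡0 = trans (C.+-congˡ y≡0) (C.+-identityʳ _)
  ... | inj₂ b₀≢0 = ⊛-cancelˡ-[] ℓ b₀≢0 λ {i} i<ℓ → begin
    (b ⊛ (k ⊛ v)) i                                ≡⟨ +0 (⊛-≈0 u kh≈0 i<ℓ) ⟨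
    (b ⊛ (k ⊛ v)) i + (u ⊛ (a ⊛ k ⊕ b ⊛ h)) i      ≡⟨ cross₂ a b k h u v i ⟩
    (b ⊛ (h ⊛ u)) i + (k ⊛ (a ⊛ u ⊕ b ⊛ v)) i      ≡⟨ +0 (⊛-≈0 k uv≈0 i<ℓ) ⟩
    (b ⊛ (h ⊛ u)) i                                ∎
    where
    +0 : ∀ {x y} → y ≡ 0# → x + y ≡ x
    +0 y≡0 = trans (C.+-congˡ y≡0) (C.+-identityʳ _)

  finite-⊛ : ∀ {f g} → Finite f → Finite g → Finite (f ⊛ g)
  finite-⊛ (d , f<d) (e , g<e) = d ℕ.+ e , deg<-⊛ d e f<d (deg<-mono (ℕ.n≤1+n e) g<e)

  finite-⊖ : ∀ {f g} → Finite f → Finite g → Finite (f ⊖ g)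
  finite-⊖ (d , f<d) (e , g<e) = d ℕ.⊔ e ,
    deg<-⊖ (deg<-mono (ℕ.m≤m⊔n d e) f<d) (deg<-mono (ℕ.m≤n⊔m d e) g<e)

  finite-⊕ : ∀ {f g} → Finite f → Finite g → Finite (f ⊕ g)
  finite-⊕ (d , f<d) (e , g<e) = d ℕ.⊔ e ,
    deg<-⊕ (deg<-mono (ℕ.m≤m⊔n d e) f<d) (deg<-mono (ℕ.m≤n⊔m d e) g<e)

  deg<-· : ∀ a {d f} → (deg< d) f → (deg< d) (a · f)
  deg<-· a f<d i d≤i = trans (C.*-congˡ (f<d i d≤i)) (C.zeroʳ a)

  deg<-pred : ∀ {d f} → f d ≡ 0# → (deg< suc d) f → (deg< d) f
  deg<-pred {d} f[d]≡0 f≤d i d≤i with ℕ.m≤n⇒m<n∨m≡n d≤i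
  ... | inj₁ d<i  = f≤d i d<i
  ... | inj₂ refl = f[d]≡0

  -- Horner's scheme: write f = f(0) + Z f′ and divide f′ first. If r is its remainder, f(0) + Z r
  -- has degree at most e, and subtracting c w, with c its coefficient at e, completes the division.
  divMonic : ∀ {e w} → MonicAt e w → ∀ d f → (deg< d) f →
             ∃₂ λ q r → Finite q × (deg< e) r × f ≗ q ⊛ w ⊕ r
  divMonic {w = w} _ zero f f<0 = 0ˢ , f , (0 , λ _ _ → refl) , deg<-mono z≤n f<0 ,
    λ i → sym (trans (C.+-congʳ (⊛-zeroˡ w i)) (C.+-identityˡ _))
  divMonic {e} {w} w-monic@(wₑ≡1 , w≤e) (suc d) f f≤d
    with divMonic w-monic d (f ∘ suc) (λ i d≤i → f≤d (suc i) (s≤s d≤i))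
  ... | q , r , (m , q<m) , r<e , f≗qw+r =
    c ◂ q , (f 0 ◂ r) ⊖ (c · w) ,
    (suc m , λ { (suc i) m≤i → q<m i (s≤s⁻¹ m≤i) }) ,
    deg<-pred remainder[e] (deg<-⊖ (λ { (suc i) e≤i → r<e i (s≤s⁻¹ e≤i) }) (deg<-· c w≤e)) ,
    division
    where
    c = (f 0 ◂ r) e
    remainder[e] : ((f 0 ◂ r) ⊖ (c · w)) e ≡ 0#
    remainder[e] = trans (C.+-congˡ (cong -_ (trans (C.*-congˡ wₑ≡1) (C.*-identityʳ c)))) (C.-‿inverseʳ c)
    a+[b-a]≡b : ∀ a b → a + (b + (- a)) ≡ b
    a+[b-a]≡b a b = trans (C.+-comm a _) (x-y+y≡x b a)
    division : f ≗ (c ◂ q) ⊛ w ⊕ ((f 0 ◂ r) ⊖ (c · w))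
    division zero    = sym (a+[b-a]≡b _ _)
    division (suc i) = begin
      f (suc i)                                        ≡⟨ f≗qw+r i ⟩
      (q ⊛ w) i + r i                                  ≡⟨ C.+-congˡ (a+[b-a]≡b (c * w (suc i)) (r i)) ⟨
      (q ⊛ w) i + (c * w (suc i) + (r i + (- (c * w (suc i)))))
                                                       ≡⟨ C.+-assoc _ _ _ ⟨
      (q ⊛ w) i + c * w (suc i) + (r i + (- (c * w (suc i))))
                                                       ≡⟨ C.+-congʳ (C.+-comm _ _) ⟩
      c * w (suc i) + (q ⊛ w) i + (r i + (- (c * w (suc i)))) ∎

  -- Divisor, cofactors and inverse are all required to be finite, since in the ring of power series
  -- every series with nonzero constant term is already a unit.
  Coprimeˢ : Series → Series → Set
  Coprimeˢ f g = ∀ q → Finite q → ∀ x y → Finite x → Finite y → x ⊛ q ≗ f → y ⊛ q ≗ g →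
                 ∃ λ c → Finite c × c ⊛ q ≗ 1ˢ

  monic-cancelˡ : ∀ {k f g} → MonicAt k f → Finite g → f ⊛ g ≗ 0ˢ → g ≗ 0ˢ
  monic-cancelˡ {f = f} {g} f-monic (d , g<d) fg≗0 =
    monic-⊛-deg< d f-monic g<d λ i _ → trans (⊛-comm g f i) (fg≗0 i)

  -- From c q = 1 follows c k = c w q = w. A nonzero c would give c k degree at least κ.
  unit-cofactor⇒0 : ∀ {κ k w q} → MonicAt κ k → (deg< κ) w → w ⊛ q ≗ k →
                    (∃ λ c → Finite c × c ⊛ q ≗ 1ˢ) → w ≗ 0ˢ
  unit-cofactor⇒0 {k = k} {w} {q} k-monic w<κ wq≗k (c , (d , c<d) , cq≗1) i =
    trans (sym (ck≗w i)) (trans (⊛-congʳ {g = k} c≗0 i) (⊛-zeroˡ k i))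
    where
    ck≗w : c ⊛ k ≗ w
    ck≗w i = begin
      (c ⊛ k) i            ≡⟨ ⊛-congˡ {c} wq≗k i ⟨
      (c ⊛ (w ⊛ q)) i      ≡⟨ ⊛-congˡ {c} (⊛-comm w q) i ⟩
      (c ⊛ (q ⊛ w)) i      ≡⟨ ⊛-assoc c q w i ⟨
      ((c ⊛ q) ⊛ w) i      ≡⟨ ⊛-congʳ cq≗1 i ⟩
      (1ˢ ⊛ w) i           ≡⟨ ⊛-identityˡ w i ⟩
      w i                  ∎
    c≗0 : c ≗ 0ˢ
    c≗0 = monic-⊛-deg< d k-monic c<d (deg<-≗ (S.sym ck≗w) w<κ)

  -- A fraction x / w equal to the reduced fraction h / k cannot have a
  -- smaller denominator. Otherwise, dividing k by a smallest such w leaves no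
  -- remainder, and the quotient is a common divisor of k and h.
  reduced⇒minimal : ∀ {κ k h} → MonicAt κ k → Finite h → Coprimeˢ k h →
    ∀ d → d ≤ κ → ∀ {w x} → (deg< d) w → Finite x → k ⊛ x ≗ h ⊛ w → w ≗ 0ˢ
  reduced⇒minimal k-monic h-finite k⊥h zero    _   w<0 _ _ i = w<0 i z≤n
  reduced⇒minimal {κ} {k} {h} k-monic@(_ , k≤κ) h-finite k⊥h (suc e) e<κ {w} {x} w≤e x-finite kx≗hw
    with w e ≟ 0#
  ... | yes wₑ≡0 = reduced⇒minimal k-monic h-finite k⊥h e (ℕ.<⇒≤ e<κ) (deg<-pred wₑ≡0 w≤e) x-finite kx≗hw
  ... | no  wₑ≢0
    with inverse (w e) wₑ≢0
  ... | b , wₑb≡1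
    with divMonic {w = b · w} (trans (C.*-comm b _) wₑb≡1 , deg<-· b w≤e) (suc κ) k k≤κ
  ... | q , r , q-finite , r<e , k≗qw+r = contradiction (trans (sym (trans (C.*-comm b _) wₑb≡1)) w′[e]≡0) 1≢0
    where
    w′ x′ x″ : Series
    w′ = b · w
    x′ = b · x
    x″ = h ⊖ q ⊛ x′
    x′-finite : Finite x′
    x′-finite = proj₁ x-finite , deg<-· b (proj₂ x-finite)
    x″-finite : Finite x″
    x″-finite = finite-⊖ h-finite (finite-⊛ q-finite x′-finite)
    h≗x″+qx′ : h ≗ x″ ⊕ q ⊛ x′
    h≗x″+qx′ i = sym (x-y+y≡x (h i) ((q ⊛ x′) i))
    ⊛-· : ∀ f g → f ⊛ (b · g) ≗ b · (f ⊛ g)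
    ⊛-· f g i = trans (⊛-comm f (b · g) i) (trans (·-⊛ b g f i) (cong (b *_) (⊛-comm g f i)))
    kx′≗hw′ : k ⊛ x′ ≗ h ⊛ w′
    kx′≗hw′ i = trans (⊛-· k x i) (trans (cong (b *_) (kx≗hw i)) (sym (⊛-· h w i)))
    -- After adding q k x′ = q h w′, both sides become h k: the left by h = x″ + q x′, the right by
    -- k = q w′ + r.
    kx″≗hr : k ⊛ x″ ≗ h ⊛ r
    kx″≗hr i = +-cancelʳ ((q ⊛ (k ⊛ x′)) i) _ _ (begin
      (k ⊛ x″) i + (q ⊛ (k ⊛ x′)) i  ≡⟨ expandˡ k x″ q x′ i ⟨
      (k ⊛ (x″ ⊕ q ⊛ x′)) i          ≡⟨ ⊛-congˡ {k} h≗x″+qx′ i ⟨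
      (k ⊛ h) i                      ≡⟨ ⊛-congʳ k≗qw+r i ⟩
      ((q ⊛ w′ ⊕ r) ⊛ h) i           ≡⟨ expandʳ h q w′ r i ⟩
      (h ⊛ r) i + (q ⊛ (h ⊛ w′)) i   ≡⟨ C.+-congˡ (⊛-congˡ {q} kx′≗hw′ i) ⟨
      (h ⊛ r) i + (q ⊛ (k ⊛ x′)) i   ∎)
    r≗0 : r ≗ 0ˢ
    r≗0 = reduced⇒minimal k-monic h-finite k⊥h e (ℕ.<⇒≤ e<κ) r<e x″-finite kx″≗hr
    x″≗0 : x″ ≗ 0ˢ
    x″≗0 = monic-cancelˡ k-monic x″-finite λ i →
      trans (kx″≗hr i) (trans (⊛-congˡ {h} r≗0 i) (S.zeroʳ h i))
    w′q≗k : w′ ⊛ q ≗ k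
    w′q≗k i = trans (⊛-comm w′ q i)
      (sym (trans (k≗qw+r i) (trans (C.+-congˡ (r≗0 i)) (C.+-identityʳ _))))
    x′q≗h : x′ ⊛ q ≗ h
    x′q≗h i = trans (⊛-comm x′ q i)
      (sym (trans (h≗x″+qx′ i) (trans (C.+-congʳ (x″≗0 i)) (C.+-identityˡ _))))
    w′[e]≡0 : w′ e ≡ 0#
    w′[e]≡0 = unit-cofactor⇒0 k-monic (deg<-mono e<κ (deg<-· b w≤e)) w′q≗k
      (k⊥h q q-finite w′ x′ (suc e , deg<-· b w≤e) x′-finite w′q≗k x′q≗h) e

  -- Order bases

  -- A weak Popov basis with rows (u₁ , v₁) and (u₂ , v₂). A degree shift by n is
  -- realised by multiplying the first column by Z^n.
  record Reduced (s₁ s₂ : ℕ) (u₁ v₁ u₂ v₂ : Series) : Set where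
    field
      u₁-monic : MonicAt s₁ u₁
      v₁-small : (deg< s₁) v₁
      u₂-small : (deg< suc s₂) u₂
      v₂-monic : MonicAt s₂ v₂

  open Reduced

  monicAt-≗ : ∀ {d f g} → f ≗ g → MonicAt d f → MonicAt d g
  monicAt-≗ f≗g (f[d]≡1 , f≤d) = trans (sym (f≗g _)) f[d]≡1 , deg<-≗ f≗g f≤d

  monicAt-shift : ∀ k {d f} → MonicAt d f → MonicAt (k ℕ.+ d) (shift k f)
  monicAt-shift k {d} {f} (f[d]≡1 , f≤d) = trans (shift-+ k f d) f[d]≡1 ,
    subst (λ e → (deg< e) (shift k f)) (ℕ.+-suc k d) (deg<-shift k f≤d)

  monicAt-⊕ : ∀ {d f g} → MonicAt d f → (deg< d) g → MonicAt d (f ⊕ g)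
  monicAt-⊕ (f[d]≡1 , f≤d) g<d =
    trans (cong₂ _+_ f[d]≡1 (g<d _ ℕ.≤-refl)) (C.+-identityʳ 1#) ,
    deg<-⊕ f≤d (deg<-mono (ℕ.n≤1+n _) g<d)

  reduced-≗ : ∀ {s₁ s₂ u₁ v₁ u₂ v₂ u₁′ v₁′ u₂′ v₂′} → u₁ ≗ u₁′ → v₁ ≗ v₁′ → u₂ ≗ u₂′ → v₂ ≗ v₂′ →
              Reduced s₁ s₂ u₁ v₁ u₂ v₂ → Reduced s₁ s₂ u₁′ v₁′ u₂′ v₂′
  reduced-≗ u₁≗ v₁≗ u₂≗ v₂≗ red = record
    { u₁-monic = monicAt-≗ u₁≗ (u₁-monic red)
    ; v₁-small = deg<-≗ v₁≗ (v₁-small red)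
    ; u₂-small = deg<-≗ u₂≗ (u₂-small red)
    ; v₂-monic = monicAt-≗ v₂≗ (v₂-monic red)
    }

  -- The alternative c = 0 occurs when the other residual already has zero constant term. Then the
  -- row of larger degree may have to be multiplied by Z, but nothing is added to the other row and
  -- no degree bound is at risk.
  deg<-·-mono : ∀ {d e c f} → c ≡ 0# ⊎ d ≤ e → (deg< d) f → (deg< e) (c · f)
  deg<-·-mono {f = f} (inj₁ refl) _   i _ = C.zeroˡ (f i)
  deg<-·-mono         (inj₂ d≤e)  f<d     = deg<-mono d≤e (deg<-· _ f<d)

  -- The matrix of leading coefficients is lower unitriangular, so for s₁ = s₂ a multiple of the
  -- first row may be added to the second but not conversely: c v₂ would bring degree s₁ into v₁.
  -- Hence ties belong to this step, and the other one asks for s₂ < s₁.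
  reduced-step₁ : ∀ {s₁ s₂ u₁ v₁ u₂ v₂} c → c ≡ 0# ⊎ s₁ ≤ s₂ → Reduced s₁ s₂ u₁ v₁ u₂ v₂ →
    Reduced (suc s₁) s₂ (shift 1 u₁) (shift 1 v₁) (c · u₁ ⊕ u₂) (c · v₁ ⊕ v₂)
  reduced-step₁ {s₁} {s₂} {u₁} {v₁} {u₂} {v₂} c c≡0∨s₁≤s₂ red = record
    { u₁-monic = monicAt-shift 1 (u₁-monic red)
    ; v₁-small = deg<-shift 1 (v₁-small red)
    ; u₂-small = deg<-⊕ (deg<-·-mono (map₂ s≤s c≡0∨s₁≤s₂) (proj₂ (u₁-monic red))) (u₂-small red)
    ; v₂-monic = monicAt-≗ (λ _ → C.+-comm _ _) (monicAt-⊕ (v₂-monic red) (deg<-·-mono c≡0∨s₁≤s₂ (v₁-small red)))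
    }

  reduced-step₂ : ∀ {s₁ s₂ u₁ v₁ u₂ v₂} c → c ≡ 0# ⊎ s₂ < s₁ → Reduced s₁ s₂ u₁ v₁ u₂ v₂ →
    Reduced s₁ (suc s₂) (u₁ ⊕ c · u₂) (v₁ ⊕ c · v₂) (shift 1 u₂) (shift 1 v₂)
  reduced-step₂ {s₁} {s₂} {u₁} {v₁} {u₂} {v₂} c c≡0∨s₂<s₁ red = record
    { u₁-monic = monicAt-⊕ (u₁-monic red) (deg<-·-mono c≡0∨s₂<s₁ (u₂-small red))
    ; v₁-small = deg<-⊕ (v₁-small red) (deg<-·-mono c≡0∨s₂<s₁ (proj₂ (v₂-monic red)))
    ; u₂-small = deg<-shift 1 (u₂-small red)
    ; v₂-monic = monicAt-shift 1 (v₂-monic red)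
    }

  combine : Series → Series → Series → Series → Series
  combine p q x y = p ⊛ x ⊕ q ⊛ y

  combine-cong : ∀ {p p′ q q′ x x′ y y′} → p ≗ p′ → q ≗ q′ → x ≗ x′ → y ≗ y′ →
                 combine p q x y ≗ combine p′ q′ x′ y′
  combine-cong p≗ q≗ x≗ y≗ i = cong₂ _+_ (⊛-cong p≗ x≗ i) (⊛-cong q≗ y≗ i)

  combine-congˡ : ∀ {p p′ q q′} x y → p ≗ p′ → q ≗ q′ → combine p q x y ≗ combine p′ q′ x y
  combine-congˡ x y p≗ q≗ = combine-cong p≗ q≗ (λ _ → refl) (λ _ → refl)

  combine-congʳ : ∀ p q {x x′ y y′} → x ≗ x′ → y ≗ y′ → combine p q x y ≗ combine p q x′ y′
  combine-congʳ p q = combine-cong {p} {p} {q} {q} (λ _ → refl) (λ _ → refl)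

  infixl 7 _⊠_
  infix  4 _≗ᴹ_

  _⊠_ : Matrix Series → Matrix Series → Matrix Series
  Q ⊠ P = matrix (combine (₁₁ Q) (₁₂ Q) (₁₁ P) (₂₁ P)) (combine (₁₁ Q) (₁₂ Q) (₁₂ P) (₂₂ P))
                 (combine (₂₁ Q) (₂₂ Q) (₁₁ P) (₂₁ P)) (combine (₂₁ Q) (₂₂ Q) (₁₂ P) (₂₂ P))

  _≗ᴹ_ : Matrix Series → Matrix Series → Set
  P ≗ᴹ Q = (₁₁ P ≗ ₁₁ Q × ₁₂ P ≗ ₁₂ Q) × (₂₁ P ≗ ₂₁ Q × ₂₂ P ≗ ₂₂ Q)

  record Entries< (d : ℕ) (P : Matrix Series) : Set where
    field
      ₁₁< : (deg< d) (₁₁ P)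
      ₁₂< : (deg< d) (₁₂ P)
      ₂₁< : (deg< d) (₂₁ P)
      ₂₂< : (deg< d) (₂₂ P)

  open Entries<

  entries<-mono : ∀ {d e P} → d ≤ e → Entries< d P → Entries< e P
  entries<-mono d≤e P<d = record
    { ₁₁< = deg<-mono d≤e (₁₁< P<d)
    ; ₁₂< = deg<-mono d≤e (₁₂< P<d)
    ; ₂₁< = deg<-mono d≤e (₂₁< P<d)
    ; ₂₂< = deg<-mono d≤e (₂₂< P<d)
    }

  entries<-≗ : ∀ {d P Q} → P ≗ᴹ Q → Entries< d P → Entries< d Q
  entries<-≗ ((≗₁₁ , ≗₁₂) , (≗₂₁ , ≗₂₂)) P<d = record
    { ₁₁< = deg<-≗ ≗₁₁ (₁₁< P<d)
    ; ₁₂< = deg<-≗ ≗₁₂ (₁₂< P<d)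
    ; ₂₁< = deg<-≗ ≗₂₁ (₂₁< P<d)
    ; ₂₂< = deg<-≗ ≗₂₂ (₂₂< P<d)
    }

  entries<-⊠ : ∀ {k l P Q} → Entries< (suc k) P → Entries< (suc l) Q → Entries< (suc (k ℕ.+ l)) (Q ⊠ P)
  entries<-⊠ {k} {l} P≤k Q≤l = record
    { ₁₁< = combine< (₁₁< Q≤l) (₁₂< Q≤l) (₁₁< P≤k) (₂₁< P≤k)
    ; ₁₂< = combine< (₁₁< Q≤l) (₁₂< Q≤l) (₁₂< P≤k) (₂₂< P≤k)
    ; ₂₁< = combine< (₂₁< Q≤l) (₂₂< Q≤l) (₁₁< P≤k) (₂₁< P≤k)
    ; ₂₂< = combine< (₂₁< Q≤l) (₂₂< Q≤l) (₁₂< P≤k) (₂₂< P≤k)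
    }
    where
    combine< : ∀ {p q x y} → (deg< suc l) p → (deg< suc l) q → (deg< suc k) x → (deg< suc k) y →
               (deg< suc (k ℕ.+ l)) (combine p q x y)
    combine< p≤l q≤l x≤k y≤k rewrite ℕ.+-comm k l =
      deg<-⊕ (deg<-⊛ (suc l) k p≤l x≤k) (deg<-⊛ (suc l) k q≤l y≤k)

  -- The basis is represented by the transformation P that produces it. Field `reduced` speaks of
  -- every reduced starting basis, so that transformations compose, and the residuals are fields
  -- because they are the input of the second half of the steps. Each step raises one of the row
  -- degrees by one, which gives `shifts`.
  record IsOrderBasis (a b : Series) (k s₁ s₂ : ℕ) (P : Matrix Series) (t₁ t₂ : ℕ) : Set where
    field
      shifts    : t₁ ℕ.+ t₂ ≡ k ℕ.+ (s₁ ℕ.+ s₂)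
      degrees   : Entries< (suc k) P
      reduced   : ∀ u₁ v₁ u₂ v₂ → Reduced s₁ s₂ u₁ v₁ u₂ v₂ →
                  Reduced t₁ t₂ (combine (₁₁ P) (₁₂ P) u₁ u₂) (combine (₁₁ P) (₁₂ P) v₁ v₂)
                                (combine (₂₁ P) (₂₂ P) u₁ u₂) (combine (₂₁ P) (₂₂ P) v₁ v₂)
      residual₁ residual₂ : Series
      order₁    : combine (₁₁ P) (₁₂ P) a b ≗ shift k residual₁
      order₂    : combine (₂₁ P) (₂₂ P) a b ≗ shift k residual₂
      unimodular : Unimodular residual₁ residual₂

  open IsOrderBasis

  isOrderBasis-≗ : ∀ {a b k s₁ s₂ P Q t₁ t₂} → P ≗ᴹ Q →
                   IsOrderBasis a b k s₁ s₂ P t₁ t₂ → IsOrderBasis a b k s₁ s₂ Q t₁ t₂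
  isOrderBasis-≗ {a} {b} P≗Q@((≗₁₁ , ≗₁₂) , (≗₂₁ , ≗₂₂)) basis = record
    { shifts     = shifts basis
    ; degrees    = entries<-≗ P≗Q (degrees basis)
    ; reduced    = λ u₁ v₁ u₂ v₂ red → reduced-≗
        (combine-congˡ u₁ u₂ ≗₁₁ ≗₁₂) (combine-congˡ v₁ v₂ ≗₁₁ ≗₁₂)
        (combine-congˡ u₁ u₂ ≗₂₁ ≗₂₂) (combine-congˡ v₁ v₂ ≗₂₁ ≗₂₂)
        (reduced basis u₁ v₁ u₂ v₂ red)
    ; residual₁  = residual₁ basis
    ; residual₂  = residual₂ basis
    ; order₁     = S.trans (combine-congˡ a b (S.sym ≗₁₁) (S.sym ≗₁₂)) (order₁ basis)
    ; order₂     = S.trans (combine-congˡ a b (S.sym ≗₂₁) (S.sym ≗₂₂)) (order₂ basis)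
    ; unimodular = unimodular basis
    }

  combine-shift : ∀ k p q x y → combine p q (shift k x) (shift k y) ≗ shift k (combine p q x y)
  combine-shift k p q x y i = trans (cong₂ _+_ (⊛-shift k p x i) (⊛-shift k q y i))
                                    (sym (shift-⊕ k (p ⊛ x) (q ⊛ y) i))

  shift-shift : ∀ k l f → shift k (shift l f) ≗ shift (k ℕ.+ l) f
  shift-shift zero    l f = λ _ → refl
  shift-shift (suc k) l f = ◂-cong (shift-shift k l f)

  -- P maps (a, b) to Z^k times its residuals, and Q maps these residuals to Z^l times new ones. So
  -- Q P reaches order k + l, and everything else is associativity. This justifies halving the
  -- problem.
  isOrderBasis-⊠ : ∀ {a b k l s₁ s₂ P t₁ t₂ Q r₁ r₂} (basis : IsOrderBasis a b k s₁ s₂ P t₁ t₂) →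
    IsOrderBasis (residual₁ basis) (residual₂ basis) l t₁ t₂ Q r₁ r₂ →
    IsOrderBasis a b (k ℕ.+ l) s₁ s₂ (Q ⊠ P) r₁ r₂
  isOrderBasis-⊠ {a} {b} {k} {l} {s₁} {s₂} {P} {t₁} {t₂} {Q} {r₁} {r₂} basis₁ basis₂ = record
    { shifts     = begin
        r₁ ℕ.+ r₂                    ≡⟨ shifts basis₂ ⟩
        l ℕ.+ (t₁ ℕ.+ t₂)            ≡⟨ cong (l ℕ.+_) (shifts basis₁) ⟩
        l ℕ.+ (k ℕ.+ (s₁ ℕ.+ s₂))    ≡⟨ ℕ.+-assoc l k _ ⟨
        l ℕ.+ k ℕ.+ (s₁ ℕ.+ s₂)      ≡⟨ cong (ℕ._+ (s₁ ℕ.+ s₂)) (ℕ.+-comm l k) ⟩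
        k ℕ.+ l ℕ.+ (s₁ ℕ.+ s₂)      ∎
    ; degrees    = entries<-⊠ (degrees basis₁) (degrees basis₂)
    ; reduced    = λ u₁ v₁ u₂ v₂ red → reduced-≗
        (S.sym (assoc₁ u₁ u₂)) (S.sym (assoc₁ v₁ v₂)) (S.sym (assoc₂ u₁ u₂)) (S.sym (assoc₂ v₁ v₂))
        (reduced basis₂ _ _ _ _ (reduced basis₁ u₁ v₁ u₂ v₂ red))
    ; residual₁  = residual₁ basis₂
    ; residual₂  = residual₂ basis₂
    ; order₁     = S.trans (assoc₁ a b) (order (₁₁ Q) (₁₂ Q) (order₁ basis₂))
    ; order₂     = S.trans (assoc₂ a b) (order (₂₁ Q) (₂₂ Q) (order₂ basis₂))
    ; unimodular = unimodular basis₂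
    }
    where
    assoc₁ : ∀ x y → combine (₁₁ (Q ⊠ P)) (₁₂ (Q ⊠ P)) x y ≗
                     combine (₁₁ Q) (₁₂ Q) (combine (₁₁ P) (₁₂ P) x y) (combine (₂₁ P) (₂₂ P) x y)
    assoc₁ x y = row-assoc (₁₁ Q) (₁₂ Q) (₁₁ P) (₁₂ P) (₂₁ P) (₂₂ P) x y
    assoc₂ : ∀ x y → combine (₂₁ (Q ⊠ P)) (₂₂ (Q ⊠ P)) x y ≗
                     combine (₂₁ Q) (₂₂ Q) (combine (₁₁ P) (₁₂ P) x y) (combine (₂₁ P) (₂₂ P) x y)
    assoc₂ x y = row-assoc (₂₁ Q) (₂₂ Q) (₁₁ P) (₁₂ P) (₂₁ P) (₂₂ P) x y
    order : ∀ p q {f} → combine p q (residual₁ basis₁) (residual₂ basis₁) ≗ shift l f →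
            combine p q (combine (₁₁ P) (₁₂ P) a b) (combine (₂₁ P) (₂₂ P) a b) ≗ shift (k ℕ.+ l) f
    order p q {f} eq = S.trans (combine-congʳ p q (order₁ basis₁) (order₂ basis₁))
      (S.trans (combine-shift k p q (residual₁ basis₁) (residual₂ basis₁))
      (S.trans (shift-cong k eq) (shift-shift k l f)))

  combine-1-0 : ∀ x y → combine 1ˢ 0ˢ x y ≗ x
  combine-1-0 x y i = trans (cong₂ _+_ (⊛-identityˡ x i) (⊛-zeroˡ y i)) (C.+-identityʳ _)

  combine-0-1 : ∀ x y → combine 0ˢ 1ˢ x y ≗ y
  combine-0-1 x y i = trans (cong₂ _+_ (⊛-zeroˡ x i) (⊛-identityˡ y i)) (C.+-identityˡ _)

  Zˢ : Series
  Zˢ = 0# ◂ 1ˢ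

  Z-⊛ : ∀ f → Zˢ ⊛ f ≗ shift 1 f
  Z-⊛ f = S.trans (0◂-⊛ 1ˢ f) (◂-cong (⊛-identityˡ f))

  combine-Z-0 : ∀ x y → combine Zˢ 0ˢ x y ≗ shift 1 x
  combine-Z-0 x y i = trans (cong₂ _+_ (Z-⊛ x i) (⊛-zeroˡ y i)) (C.+-identityʳ _)

  combine-0-Z : ∀ x y → combine 0ˢ Zˢ x y ≗ shift 1 y
  combine-0-Z x y i = trans (cong₂ _+_ (⊛-zeroˡ x i) (Z-⊛ y i)) (C.+-identityˡ _)

  ◂0-⊛ : ∀ c f → (c ◂ 0ˢ) ⊛ f ≗ c · f
  ◂0-⊛ c f = constant-⊛ {c ◂ 0ˢ} f (λ _ → refl)

  combine-c-1 : ∀ c x y → combine (c ◂ 0ˢ) 1ˢ x y ≗ c · x ⊕ y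
  combine-c-1 c x y i = cong₂ _+_ (◂0-⊛ c x i) (⊛-identityˡ y i)

  combine-1-c : ∀ c x y → combine 1ˢ (c ◂ 0ˢ) x y ≗ x ⊕ c · y
  combine-1-c c x y i = cong₂ _+_ (⊛-identityˡ x i) (◂0-⊛ c y i)

  deg<-0ˢ : ∀ {d} → (deg< d) 0ˢ
  deg<-0ˢ _ _ = refl

  deg<-1ˢ : (deg< 1) 1ˢ
  deg<-1ˢ (suc i) _ = refl

  deg<-◂ : ∀ {d a f} → (deg< d) f → (deg< suc d) (a ◂ f)
  deg<-◂ f<d (suc i) d<i = f<d i (s≤s⁻¹ d<i)

  isOrderBasis-0 : ∀ {a b s₁ s₂} → Unimodular a b →
                   IsOrderBasis a b 0 s₁ s₂ (matrix 1ˢ 0ˢ 0ˢ 1ˢ) s₁ s₂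
  isOrderBasis-0 {a} {b} a⊥b = record
    { shifts     = refl
    ; degrees    = record { ₁₁< = deg<-1ˢ ; ₁₂< = deg<-0ˢ ; ₂₁< = deg<-0ˢ ; ₂₂< = deg<-1ˢ }
    ; reduced    = λ u₁ v₁ u₂ v₂ → reduced-≗
        (S.sym (combine-1-0 u₁ u₂)) (S.sym (combine-1-0 v₁ v₂))
        (S.sym (combine-0-1 u₁ u₂)) (S.sym (combine-0-1 v₁ v₂))
    ; residual₁  = a
    ; residual₂  = b
    ; order₁     = combine-1-0 a b
    ; order₂     = combine-0-1 a b
    ; unimodular = a⊥b
    }

  -- Elimination clears the constant term of the second residual, which can then be divided by Z.
  -- The first row gains its order from the factor Z and keeps its residual, whose nonzero constant
  -- term preserves unimodularity.
  isOrderBasis-step₁ : ∀ {a b s₁ s₂} c → a 0 ≢ 0# → c * a 0 + b 0 ≡ 0# → c ≡ 0# ⊎ s₁ ≤ s₂ →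
    IsOrderBasis a b 1 s₁ s₂ (matrix Zˢ 0ˢ (c ◂ 0ˢ) 1ˢ) (suc s₁) s₂
  isOrderBasis-step₁ {a} {b} c a₀≢0 eliminated c≡0∨s₁≤s₂ = record
    { shifts     = refl
    ; degrees    = record
      { ₁₁< = deg<-◂ deg<-1ˢ ; ₁₂< = deg<-0ˢ ; ₂₁< = deg<-◂ deg<-0ˢ ; ₂₂< = deg<-mono (s≤s z≤n) deg<-1ˢ }
    ; reduced    = λ u₁ v₁ u₂ v₂ red → reduced-≗
        (S.sym (combine-Z-0 u₁ u₂)) (S.sym (combine-Z-0 v₁ v₂))
        (S.sym (combine-c-1 c u₁ u₂)) (S.sym (combine-c-1 c v₁ v₂))
        (reduced-step₁ c c≡0∨s₁≤s₂ red)
    ; residual₁  = a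
    ; residual₂  = (c · a ⊕ b) ∘ suc
    ; order₁     = combine-Z-0 a b
    ; order₂     = S.trans (combine-c-1 c a b) (S.sym (shift-≗ 1 (c · a ⊕ b) λ { {zero} _ → eliminated ; {suc _} (s≤s ()) }))
    ; unimodular = inj₁ a₀≢0
    }

  isOrderBasis-step₂ : ∀ {a b s₁ s₂} c → b 0 ≢ 0# → a 0 + c * b 0 ≡ 0# → c ≡ 0# ⊎ s₂ < s₁ →
    IsOrderBasis a b 1 s₁ s₂ (matrix 1ˢ (c ◂ 0ˢ) 0ˢ Zˢ) s₁ (suc s₂)
  isOrderBasis-step₂ {a} {b} {s₁} {s₂} c b₀≢0 eliminated c≡0∨s₂<s₁ = record
    { shifts     = ℕ.+-suc s₁ s₂
    ; degrees    = record
      { ₁₁< = deg<-mono (s≤s z≤n) deg<-1ˢ ; ₁₂< = deg<-◂ deg<-0ˢ ; ₂₁< = deg<-0ˢ ; ₂₂< = deg<-◂ deg<-1ˢ }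
    ; reduced    = λ u₁ v₁ u₂ v₂ red → reduced-≗
        (S.sym (combine-1-c c u₁ u₂)) (S.sym (combine-1-c c v₁ v₂))
        (S.sym (combine-0-Z u₁ u₂)) (S.sym (combine-0-Z v₁ v₂))
        (reduced-step₂ c c≡0∨s₂<s₁ red)
    ; residual₁  = (a ⊕ c · b) ∘ suc
    ; residual₂  = b
    ; order₁     = S.trans (combine-1-c c a b) (S.sym (shift-≗ 1 (a ⊕ c · b) λ { {zero} _ → eliminated ; {suc _} (s≤s ()) }))
    ; order₂     = combine-0-Z a b
    ; unimodular = inj₂ b₀≢0
    }

  -- Recognising the solution in the first row

  ⊛-⊖ : ∀ f g e → f ⊛ (g ⊖ e) ≗ f ⊛ g ⊖ f ⊛ e
  ⊛-⊖ f g e i = trans (S.distribˡ f g (⊝ e) i) (C.+-congˡ (sym (-‿distribʳ-⊛ f e i)))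

  combine-comm : ∀ p q x y → combine p q x y ≗ combine x y p q
  combine-comm p q x y i = cong₂ _+_ (⊛-comm p x i) (⊛-comm q y i)

  record IsReducedFraction (n ℓ : ℕ) (a b : Series) (κ : ℕ) (k h : Series) : Set where
    field
      k-monic  : MonicAt κ k
      h-small  : (deg< κ ℕ.+ n) h
      degrees≤ : κ ℕ.+ (κ ℕ.+ n) ≤ ℓ
      coprime  : Coprimeˢ k h
      order    : combine a b k h ≈[ ℓ ] 0ˢ

  -- The second row cannot be small, and as the row degrees add up to ℓ + n, the first row cannot be
  -- large. Then k v and h u, with (u, v) the first row, both have degree below κ + t₁ ≤ ℓ, so their
  -- congruence is an equality. As h / k is reduced, the denominator u has degree at least κ, hence
  -- exactly κ.
  orderBasis-solves : ∀ {a b ℓ n P t₁ t₂ κ k h} → Unimodular a b →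
    IsOrderBasis a b ℓ n 0 P t₁ t₂ → IsReducedFraction n ℓ a b κ k h → ₁₁ P ≗ k × ₁₂ P ≗ h
  orderBasis-solves {a} {b} {ℓ} {n} {P} {t₁} {t₂} {κ} {k} {h} a⊥b basis target = u≗k , v≗h
    where
    open IsReducedFraction target

    red : Reduced t₁ t₂ (shift n (₁₁ P)) (₁₂ P) (shift n (₂₁ P)) (₂₂ P)
    red = reduced-≗ (column₁ (₁₁ P) (₁₂ P)) (column₂ (₁₁ P) (₁₂ P)) (column₁ (₂₁ P) (₂₂ P)) (column₂ (₂₁ P) (₂₂ P))
      (reduced basis (shift n 1ˢ) 0ˢ 0ˢ 1ˢ record
        { u₁-monic = subst (λ d → MonicAt d (shift n 1ˢ)) (ℕ.+-identityʳ n) (monicAt-shift n (refl , deg<-1ˢ))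
        ; v₁-small = deg<-0ˢ
        ; u₂-small = deg<-0ˢ
        ; v₂-monic = refl , deg<-1ˢ
        })
      where
      column₁ : ∀ p q → combine p q (shift n 1ˢ) 0ˢ ≗ shift n p
      column₁ p q i = trans (cong₂ _+_ (trans (⊛-shift n p 1ˢ i) (shift-cong n (S.*-identityʳ p) i)) (S.zeroʳ q i))
                            (C.+-identityʳ _)
      column₂ : ∀ p q → combine p q 0ˢ 1ˢ ≗ q
      column₂ p q i = trans (cong₂ _+_ (S.zeroʳ p i) (S.*-identityʳ q i)) (C.+-identityˡ _)

    rows-order : ∀ p q {f} → combine p q a b ≗ shift ℓ f → combine a b p q ≈[ ℓ ] 0ˢ
    rows-order p q {f} eq {i} i<ℓ = trans (combine-comm a b p q i) (trans (eq i) (shift-< ℓ f i<ℓ))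

    t₁+t₂≡ℓ+n : t₁ ℕ.+ t₂ ≡ ℓ ℕ.+ n
    t₁+t₂≡ℓ+n = trans (shifts basis) (cong (ℓ ℕ.+_) (ℕ.+-identityʳ n))

    -- Otherwise k ₂₂ − h ₂₁ would be monic of degree κ + t₂ < ℓ.
    ℓ≤κ+t₂ : ℓ ≤ κ ℕ.+ t₂
    ℓ≤κ+t₂ = ℕ.≮⇒≥ λ κ+t₂<ℓ → 1≢0 (begin
      1#                                                  ≡⟨ C.*-identityʳ 1# ⟨
      1# * 1#                                             ≡⟨ cong₂ _*_ (proj₁ k-monic) (proj₁ (v₂-monic red)) ⟨
      k κ * ₂₂ P t₂                                       ≡⟨ leading-⊛ κ t₂ (proj₂ k-monic) (proj₂ (v₂-monic red)) ⟨
      (k ⊛ ₂₂ P) (κ ℕ.+ t₂)                               ≡⟨ cross a⊥b order (rows-order (₂₁ P) (₂₂ P) (order₂ basis)) κ+t₂<ℓ ⟩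
      (h ⊛ ₂₁ P) (κ ℕ.+ t₂)                               ≡⟨ shift-+ n (h ⊛ ₂₁ P) (κ ℕ.+ t₂) ⟨
      shift n (h ⊛ ₂₁ P) (n ℕ.+ (κ ℕ.+ t₂))               ≡⟨ ⊛-shift n h (₂₁ P) _ ⟨
      (h ⊛ shift n (₂₁ P)) (n ℕ.+ (κ ℕ.+ t₂))             ≡⟨ deg<-⊛ (κ ℕ.+ n) t₂ h-small (u₂-small red) _ (ℕ.≤-reflexive reorder) ⟩
      0#                                                  ∎)
      where
      reorder : κ ℕ.+ n ℕ.+ t₂ ≡ n ℕ.+ (κ ℕ.+ t₂)
      reorder = trans (cong (ℕ._+ t₂) (ℕ.+-comm κ n)) (ℕ.+-assoc n κ t₂)

    -- Substitute t₁ + t₂ = ℓ + n into the lower bound for t₂.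
    t₁≤κ+n : t₁ ≤ κ ℕ.+ n
    t₁≤κ+n = ℕ.+-cancelʳ-≤ t₂ t₁ (κ ℕ.+ n) (ℕ.≤-trans (ℕ.≤-reflexive t₁+t₂≡ℓ+n)
      (ℕ.≤-trans (ℕ.+-monoˡ-≤ n ℓ≤κ+t₂) (ℕ.≤-reflexive (trans (ℕ.+-assoc κ t₂ n)
        (trans (cong (κ ℕ.+_) (ℕ.+-comm t₂ n)) (sym (ℕ.+-assoc κ n t₂)))))))

    κ+t₁≤ℓ : κ ℕ.+ t₁ ≤ ℓ
    κ+t₁≤ℓ = ℕ.≤-trans (ℕ.+-monoʳ-≤ κ t₁≤κ+n) degrees≤

    kv≗hu : k ⊛ ₁₂ P ≗ h ⊛ ₁₁ P
    kv≗hu i with i ℕ.<? ℓ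
    ... | yes i<ℓ = cross a⊥b order (rows-order (₁₁ P) (₁₂ P) (order₁ basis)) i<ℓ
    ... | no  i≮ℓ = trans (kv<κ+t₁ i κ+t₁≤i) (sym (hu<κ+t₁ i κ+t₁≤i))
      where
      κ+t₁≤i : κ ℕ.+ t₁ ≤ i
      κ+t₁≤i = ℕ.≤-trans κ+t₁≤ℓ (ℕ.≮⇒≥ i≮ℓ)
      kv<κ+t₁ : (deg< κ ℕ.+ t₁) (k ⊛ ₁₂ P)
      kv<κ+t₁ j κ+t₁≤j = trans (⊛-comm k (₁₂ P) j)
        (deg<-⊛ t₁ κ (v₁-small red) (proj₂ k-monic) j (ℕ.≤-trans (ℕ.≤-reflexive (ℕ.+-comm t₁ κ)) κ+t₁≤j))
      hu<κ+t₁ : (deg< κ ℕ.+ t₁) (h ⊛ ₁₁ P)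
      hu<κ+t₁ = deg<-unshift n (deg<-≗ (⊛-shift n h (₁₁ P))
        (subst (λ d → (deg< d) (h ⊛ shift n (₁₁ P))) (trans (cong (ℕ._+ t₁) (ℕ.+-comm κ n)) (ℕ.+-assoc n κ t₁))
          (deg<-⊛ (κ ℕ.+ n) t₁ h-small (proj₂ (u₁-monic red)))))

    n≤t₁ : n ≤ t₁
    n≤t₁ = ℕ.≮⇒≥ λ t₁<n → 1≢0 (trans (sym (proj₁ (u₁-monic red))) (shift-< n (₁₁ P) t₁<n))

    d : ℕ
    d = t₁ ℕ.∸ n

    n+d≡t₁ : n ℕ.+ d ≡ t₁
    n+d≡t₁ = ℕ.m+[n∸m]≡n n≤t₁

    u-monic : MonicAt d (₁₁ P)
    u-monic = trans (sym (shift-+ n (₁₁ P) d)) (trans (cong (shift n (₁₁ P)) n+d≡t₁) (proj₁ (u₁-monic red))) ,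
      deg<-unshift n (subst (λ e → (deg< e) (shift n (₁₁ P))) (sym (trans (ℕ.+-suc n d) (cong suc n+d≡t₁))) (proj₂ (u₁-monic red)))

    d≤κ : d ≤ κ
    d≤κ = ℕ.+-cancelˡ-≤ n d κ (ℕ.≤-trans (ℕ.≤-reflexive n+d≡t₁) (ℕ.≤-trans t₁≤κ+n (ℕ.≤-reflexive (ℕ.+-comm κ n))))

    h-finite v-finite : Finite _
    h-finite = κ ℕ.+ n , h-small
    v-finite = suc ℓ , ₁₂< (degrees basis)

    κ≤d : κ ≤ d
    κ≤d = ℕ.≮⇒≥ λ d<κ → 1≢0 (trans (sym (proj₁ u-monic))
      (reduced⇒minimal k-monic h-finite coprime (suc d) d<κ (proj₂ u-monic) v-finite kv≗hu d))

    -- Both are monic of degree κ, and k (v - h) = h (u - k). So u - k is a denominator of degree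
    -- below κ for the same fraction, and must vanish.
    u≗k : ₁₁ P ≗ k
    u≗k i = x-y≡0⇒x≡y _ _ (u-k≗0 i)
      where
      u-k≗0 : ₁₁ P ⊖ k ≗ 0ˢ
      u-k≗0 = reduced⇒minimal k-monic h-finite coprime κ ℕ.≤-refl
        (deg<-pred (trans (cong₂ (λ x y → x + (- y)) (trans (cong (₁₁ P) (ℕ.≤-antisym κ≤d d≤κ)) (proj₁ u-monic)) (proj₁ k-monic)) (C.-‿inverseʳ 1#))
          (deg<-⊖ (deg<-mono (s≤s d≤κ) (proj₂ u-monic)) (proj₂ k-monic)))
        (finite-⊖ v-finite h-finite)
        λ i → trans (⊛-⊖ k (₁₂ P) h i) (trans (cong₂ (λ x y → x + (- y)) (kv≗hu i) (⊛-comm k h i)) (sym (⊛-⊖ h (₁₁ P) k i)))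

    v≗h : ₁₂ P ≗ h
    v≗h i = x-y≡0⇒x≡y _ _ (monic-cancelˡ k-monic (finite-⊖ v-finite h-finite)
      (λ j → trans (⊛-⊖ k (₁₂ P) h j) (trans (C.+-congʳ (trans (kv≗hu j) (trans (⊛-congˡ {h} u≗k j) (⊛-comm h k j)))) (C.-‿inverseʳ _))) i)

  coprimeˢ-sym : ∀ {f g} → Coprimeˢ f g → Coprimeˢ g f
  coprimeˢ-sym f⊥g q q-finite x y x-finite y-finite xq≗g yq≗f =
    f⊥g q q-finite y x y-finite x-finite yq≗f xq≗g

  coprimeˢ-⊖ : ∀ n {k l} → Coprimeˢ k l → Coprimeˢ k (l ⊖ shift n k)
  coprimeˢ-⊖ n {k} {l} k⊥l q q-finite x y x-finite@(d , x<d) y-finite xq≗k yq≗l-Zⁿk =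
    k⊥l q q-finite x (y ⊕ shift n x) x-finite (finite-⊕ y-finite (n ℕ.+ d , deg<-shift n x<d)) xq≗k
    λ i → begin
      ((y ⊕ shift n x) ⊛ q) i            ≡⟨ ⊛-distribʳ q y (shift n x) i ⟩
      (y ⊛ q) i + (shift n x ⊛ q) i      ≡⟨ cong₂ _+_ (yq≗l-Zⁿk i) (trans (shift-⊛ n x q i) (shift-cong n xq≗k i)) ⟩
      l i + (- shift n k i) + shift n k i  ≡⟨ x-y+y≡x (l i) (shift n k i) ⟩
      l i                                ∎

  -- The polynomials l and Z^n k are both monic of degree κ + n, so their leading terms cancel; this
  -- is the origin of `h-small`.
  isReducedFraction-⊖ : ∀ {n ℓ a b κ k l} → MonicAt κ k → MonicAt (κ ℕ.+ n) l → κ ℕ.+ (κ ℕ.+ n) ≤ ℓ →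
    Coprimeˢ k l → combine a b k (l ⊖ shift n k) ≈[ ℓ ] 0ˢ → IsReducedFraction n ℓ a b κ k (l ⊖ shift n k)
  isReducedFraction-⊖ {n} {κ = κ} {k} {l} k-monic l-monic degrees≤ k⊥l order = record
    { k-monic  = k-monic
    ; h-small  = deg<-pred
        (trans (cong₂ (λ x y → x + (- y)) (proj₁ l-monic) (proj₁ Zⁿk-monic)) (C.-‿inverseʳ 1#))
        (deg<-⊖ (proj₂ l-monic) (proj₂ Zⁿk-monic))
    ; degrees≤ = degrees≤
    ; coprime  = coprimeˢ-⊖ n k⊥l
    ; order    = order
    }
    where
    Zⁿk-monic : MonicAt (κ ℕ.+ n) (shift n k)
    Zⁿk-monic = subst (λ d → MonicAt d (shift n k)) (ℕ.+-comm n κ) (monicAt-shift n k-monic)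

  shift-· : ∀ n c f → shift n (c · f) ≗ c · shift n f
  shift-· zero    c f i       = refl
  shift-· (suc n) c f zero    = sym (C.zeroʳ c)
  shift-· (suc n) c f (suc i) = shift-· n c f i

  [-1]·x+x≡0 : ∀ {c} → c ≡ - 1# → ∀ x → c * x + x ≡ 0#
  [-1]·x+x≡0 refl x = trans (C.+-congʳ (-1*x≈-x x)) (C.-‿inverseˡ x)

  -1≢0 : ∀ {c} → c ≡ - 1# → c ≢ 0#
  -1≢0 {c} c≡-1 c≡0 = 1≢0 (begin
    1#             ≡⟨ C.+-identityˡ 1# ⟨
    0# + 1#        ≡⟨ C.+-congʳ (C.zeroˡ 1#) ⟨
    0# * 1# + 1#   ≡⟨ cong (λ x → x * 1# + 1#) c≡0 ⟨
    c * 1# + 1#    ≡⟨ [-1]·x+x≡0 c≡-1 1# ⟩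
    0#             ∎)

  -- (r - Z^n) g - (f - Z^n g) = r g - f. The factor c stands for -1 and is a variable because the
  -- program obtains it as 0 - 1, equal to -1 only up to a proof.
  order⁺ : ∀ n {ℓ c r f g} → c ≡ - 1# → r ⊛ g ≈[ ℓ ] f →
           combine (r ⊕ shift n (c ◂ 0ˢ)) (c ◂ 0ˢ) g (f ⊖ shift n g) ≈[ ℓ ] 0ˢ
  order⁺ n {ℓ} {c} {r} {f} {g} c≡-1 rg≈f {i} i<ℓ = begin
    ((r ⊕ shift n (c ◂ 0ˢ)) ⊛ g) i + ((c ◂ 0ˢ) ⊛ (f ⊖ Zⁿg)) i
      ≡⟨ cong₂ _+_ (trans (⊛-distribʳ g r (shift n (c ◂ 0ˢ)) i) (cong₂ _+_ (rg≈f i<ℓ) cZⁿg)) (◂0-⊛ c (f ⊖ Zⁿg) i) ⟩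
    f i + c * Zⁿg i + c * (f i + (- Zⁿg i))
      ≡⟨ C.+-assoc _ _ _ ⟩
    f i + (c * Zⁿg i + c * (f i + (- Zⁿg i)))
      ≡⟨ C.+-congˡ (trans (sym (C.distribˡ c _ _)) (cong (c *_) (trans (C.+-comm _ _) (x-y+y≡x (f i) (Zⁿg i))))) ⟩
    f i + c * f i
      ≡⟨ trans (C.+-comm _ _) ([-1]·x+x≡0 c≡-1 (f i)) ⟩
    0# ∎
    where
    Zⁿg = shift n g
    cZⁿg : (shift n (c ◂ 0ˢ) ⊛ g) i ≡ c * Zⁿg i
    cZⁿg = trans (shift-⊛ n (c ◂ 0ˢ) g i) (trans (shift-cong n (◂0-⊛ c g) i) (shift-· n c g i))

  order⁻ : ∀ n {ℓ c r f g} → c ≡ - 1# → r ⊛ g ≈[ ℓ ] f →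
           combine ((c ◂ 0ˢ) ⊕ shift n r) r f (g ⊖ shift n f) ≈[ ℓ ] 0ˢ
  order⁻ n {ℓ} {c} {r} {f} {g} c≡-1 rg≈f {i} i<ℓ = begin
    (((c ◂ 0ˢ) ⊕ shift n r) ⊛ f) i + (r ⊛ (g ⊖ shift n f)) i
      ≡⟨ cong₂ _+_ (trans (⊛-distribʳ f (c ◂ 0ˢ) (shift n r) i) (cong₂ _+_ (◂0-⊛ c f i) (shift-⊛ n r f i)))
                   (trans (⊛-⊖ r g (shift n f) i) (cong₂ (λ x y → x + (- y)) (rg≈f i<ℓ) (⊛-shift n r f i))) ⟩
    c * f i + x + (f i + (- x))
      ≡⟨ C.+-assoc _ _ _ ⟩
    c * f i + (x + (f i + (- x)))
      ≡⟨ C.+-congˡ (trans (C.+-comm _ _) (x-y+y≡x (f i) x)) ⟩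
    c * f i + f i
      ≡⟨ [-1]·x+x≡0 c≡-1 (f i) ⟩
    0# ∎
    where
    x = shift n (r ⊛ f) i

  -- The summand 0 makes this literally the value that the program computes by a division followed
  -- by a subtraction from zero.
  eliminator : A → A → A
  eliminator y x⁻¹ = 0# + (- (y * x⁻¹))

  eliminator-eliminates : ∀ {x x⁻¹} y → x * x⁻¹ ≡ 1# → eliminator y x⁻¹ * x + y ≡ 0#
  eliminator-eliminates {x} {x⁻¹} y xx⁻¹≡1 = begin
    (0# + (- (y * x⁻¹))) * x + y    ≡⟨ C.+-congʳ (C.*-congʳ (C.+-identityˡ _)) ⟩
    (- (y * x⁻¹)) * x + y           ≡⟨ C.+-congʳ (sym (-‿distribˡ-* (y * x⁻¹) x)) ⟩
    - (y * x⁻¹ * x) + y             ≡⟨ C.+-congʳ (cong -_ (trans (C.*-assoc y x⁻¹ x) (C.*-congˡ (trans (C.*-comm x⁻¹ x) xx⁻¹≡1)))) ⟩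
    - (y * 1#) + y                  ≡⟨ C.+-congʳ (cong -_ (C.*-identityʳ y)) ⟩
    - y + y                         ≡⟨ C.-‿inverseˡ y ⟩
    0#                              ∎

  eliminator-0 : ∀ {y} x⁻¹ → y ≡ 0# → eliminator y x⁻¹ ≡ 0#
  eliminator-0 x⁻¹ refl = trans (C.+-identityˡ _) (trans (cong -_ (C.zeroˡ x⁻¹)) -0#≈0#)

open import Data.Integer using (ℤ; +_; -_; -[1+_]) renaming (_≤_ to _≤ᶻ_)
open import Data.Nat using (_+_; _*_; _∸_)

-- The algorithm

open Matrix

private variable
  X α β : Set

infixl 1 _>>=_

_>>=_ : Program X α → (α → Program X β) → Program X β
return y        >>= f = f y
zero# k         >>= f = zero# λ x → k x >>= f
one# k          >>= f = one# λ x → k x >>= f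
op o x y k      >>= f = op o x y λ z → k z >>= f
isZero? x k     >>= f = isZero? x λ b → k b >>= f
polyMul n P Q k >>= f = polyMul n P Q λ S → k S >>= f

pad : X → ∀ n → List X → Vec X n
pad z zero    _        = []ᵛ
pad z (suc n) []       = z ∷ᵛ pad z n []
pad z (suc n) (x ∷ xs) = x ∷ᵛ pad z n xs

addP : List X → List X → Program X (List X)
addP []      Q       = return Q
addP (a ∷ P) []      = return (a ∷ P)
addP (a ∷ P) (b ∷ Q) = op add a b λ c → addP P Q >>= λ S → return (c ∷ S)

-- The product modulo Z^(n+1).
mulP : ℕ → List X → List X → Program X (List X)
mulP n P Q = zero# λ z → polyMul n (pad z (suc n) P) (pad z (suc n) Q) λ S →
  return (take (suc n) (toList S))

combineP : ℕ → (P Q S T : List X) → Program X (List X)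
combineP n P Q S T = mulP n P S >>= λ U → mulP n Q T >>= λ V → addP U V

mulM : ℕ → (Q P : Matrix (List X)) → Program X (Matrix (List X))
mulM n Q P =
  combineP n (₁₁ Q) (₁₂ Q) (₁₁ P) (₂₁ P) >>= λ a →
  combineP n (₁₁ Q) (₁₂ Q) (₁₂ P) (₂₂ P) >>= λ b →
  combineP n (₂₁ Q) (₂₂ Q) (₁₁ P) (₂₁ P) >>= λ c →
  combineP n (₂₁ Q) (₂₂ Q) (₁₂ P) (₂₂ P) >>= λ d →
  return (matrix a b c d)

headOr : X → List X → X
headOr z []      = z
headOr z (x ∷ _) = x

Basis : Set → Set
Basis X = Matrix (List X) × ℕ × ℕ

eliminate₁ eliminate₂ : (z o a b : X) → ℕ → ℕ → Program X (Basis X)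
eliminate₁ z o a b s₁ s₂ = op div b a λ c → op sub z c λ c′ →
  return (matrix (z ∷ o ∷ []) [] (c′ ∷ []) (o ∷ []) , suc s₁ , s₂)
eliminate₂ z o a b s₁ s₂ = op div a b λ c → op sub z c λ c′ →
  return (matrix (o ∷ []) (c′ ∷ []) [] (z ∷ o ∷ []) , s₁ , suc s₂)

-- The row that is multiplied by Z has nonzero constant residual, and its
-- shifted degree is the smaller one if both residuals are nonzero.
useFirst : (a≟0 b≟0 : Bool) (s₁ s₂ : ℕ) → Bool
useFirst a≟0 b≟0 s₁ s₂ = not a≟0 ∧ (b≟0 ∨ (s₁ ≤ᵇ s₂))

stepBasis : (s₁ s₂ : ℕ) → List X → List X → Program X (Basis X)
stepBasis s₁ s₂ as bs = zero# λ z → one# λ o →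
  isZero? (headOr z as) λ a≟0 → isZero? (headOr z bs) λ b≟0 →
  if useFirst a≟0 b≟0 s₁ s₂
    then eliminate₁ z o (headOr z as) (headOr z bs) s₁ s₂
    else eliminate₂ z o (headOr z as) (headOr z bs) s₁ s₂

orderBasis : (h k s₁ s₂ : ℕ) → List X → List X → Program X (Basis X)
glue : (h k : ℕ) → List X → List X → Basis X → Program X (Basis X)
multiplyBases : (h : ℕ) → (P Q : Basis X) → Program X (Basis X)

-- Performs k ≤ 2^h steps.
orderBasis zero    zero    s₁ s₂ as bs = one# λ o → return (matrix (o ∷ []) [] [] (o ∷ []) , s₁ , s₂)
orderBasis zero    (suc _) s₁ s₂ as bs = stepBasis s₁ s₂ as bs
orderBasis (suc h) k       s₁ s₂ as bs with k ≤? 2 ℕ.^ h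
-- Skipping a level when there is nothing to split lets k be any number up to 2^h, while h provides
-- the structural recursion.
... | yes _ = orderBasis h k s₁ s₂ as bs
... | no  _ = orderBasis h (2 ℕ.^ h) s₁ s₂ as bs >>= glue h k as bs

glue h k as bs (P , t₁ , t₂) =
  -- The product is needed below index k ≤ 2^(h+1) only. Later coefficients may be wrong; they do
  -- not influence the remaining steps.
  combineP (2 ℕ.^ suc h) (₁₁ P) (₁₂ P) as bs >>= λ as′ →
  combineP (2 ℕ.^ suc h) (₂₁ P) (₂₂ P) as bs >>= λ bs′ →
  orderBasis h (k ∸ 2 ℕ.^ h) t₁ t₂ (drop (2 ℕ.^ h) as′) (drop (2 ℕ.^ h) bs′) >>=
  multiplyBases h (P , t₁ , t₂)

multiplyBases h (P , _) (Q , r₁ , r₂) = mulM (2 ℕ.^ suc h) Q P >>= λ M → return (M , r₁ , r₂)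

solveFraction : (ℓ n : ℕ) (z : X) → List X → List X → Program X (List X × List X)
solveFraction ℓ n z as bs = orderBasis ⌈log₂ ℓ ⌉ ℓ n 0 as bs >>= λ (P , _) →
  -- The second entry has degree at most ℓ, so `take` does not change the polynomial. It bounds the
  -- length of the list and thereby the cost of the addition.
  addP (replicate n z ++ ₁₁ P) (take (suc ℓ) (₁₂ P)) >>= λ S → return (₁₁ P , S)

-- For m = n ≥ 0, the congruence is (R − Z^n) G − (F − Z^n G) ≡ 0; for m = − n < 0,
-- it is (Z^n R − 1) F + R (G − Z^n F) ≡ 0.
d-rfr : Algorithm
d-rfr ℓ (+ n) R = zero# λ z → one# λ o → op sub z o λ -o →
  addP (toList R) (replicate n z ++ -o ∷ []) >>= λ as →
  solveFraction ℓ n z as (-o ∷ []) >>= λ (G , F) → return (F , G)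
d-rfr ℓ -[1+ n ] R = zero# λ z → one# λ o → op sub z o λ -o →
  addP (-o ∷ []) (replicate (suc n) z ++ toList R) >>= λ as →
  solveFraction ℓ (suc n) z as (toList R)

-- Operation counts

combineCost basisCost algorithmCost : (ℕ → ℕ) → ℕ → ℕ
combineCost M n = (1 + M n) + ((1 + M n) + suc n)

-- One elementary step: two constants, two zero tests, a division and a subtraction.
basisCost M zero    = 6
-- Two residuals and four matrix entries account for the six copies of `c`, nested in the order in
-- which the program runs.
basisCost M (suc h) = basisCost M h + (c + (c + (basisCost M h + (c + (c + (c + c))))))
  where c = combineCost M (2 ℕ.^ suc h)

-- The 3 pays for the constants 0, 1 and -1. The term `1 + ℓ` covers the initial addition for either
-- sign of m, and `suc ℓ` the final one.
algorithmCost M ℓ = 3 + ((1 + ℓ) + (basisCost M ⌈log₂ ℓ ⌉ + suc ℓ))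

module _ {p : ℕ} .{{_ : NonZero p}} where

  -1ᶠ : 𝔽 p
  -1ᶠ = 0ᶠ -ᶠ 1ᶠ

  run->>= : (m : Program (𝔽 p) α) (f : α → Program (𝔽 p) β) → run (m >>= f) ≡ run (f (run m))
  run->>= (return y)        f = refl
  run->>= (zero# k)         f = run->>= (k 0ᶠ) f
  run->>= (one# k)          f = run->>= (k 1ᶠ) f
  run->>= (op o x y k)      f = run->>= (k (⟦ o ⟧ x y)) f
  run->>= (isZero? x k)     f = run->>= (k _) f
  run->>= (polyMul n P Q k) f = run->>= (k (polyProduct n P Q)) f

  module _ (M : ℕ → ℕ) where

    cost->>= : (m : Program (𝔽 p) α) (f : α → Program (𝔽 p) β) →
               cost M (m >>= f) ≡ cost M m + cost M (f (run m))
    cost->>= (return y)        f = refl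
    cost->>= (zero# k)         f = cong suc (cost->>= (k 0ᶠ) f)
    cost->>= (one# k)          f = cong suc (cost->>= (k 1ᶠ) f)
    cost->>= (op o x y k)      f = cong suc (cost->>= (k (⟦ o ⟧ x y)) f)
    cost->>= (isZero? x k)     f = cong suc (cost->>= (k _) f)
    cost->>= (polyMul n P Q k) f = trans (cong (λ c → M n + c) (cost->>= (k (polyProduct n P Q)) f))
                                         (sym (ℕ.+-assoc (M n) _ _))

    cost->>=-≤ : ∀ {c d} (m : Program (𝔽 p) α) {f : α → Program (𝔽 p) β} →
                 cost M m ≤ c → (∀ y → cost M (f y) ≤ d) → cost M (m >>= f) ≤ c + d
    cost->>=-≤ m {f} m≤c f≤d = ℕ.≤-trans (ℕ.≤-reflexive (cost->>= m f)) (ℕ.+-mono-≤ m≤c (f≤d (run m)))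

    cost-return-≤ : ∀ {c} (m : Program (𝔽 p) α) (f : α → β) → cost M m ≤ c →
                    cost M (m >>= λ y → return (f y)) ≤ c
    cost-return-≤ m f m≤c =
      ℕ.≤-trans (ℕ.≤-reflexive (trans (cost->>= m (λ y → return (f y))) (ℕ.+-identityʳ _))) m≤c

    -- Addition stops at the end of the shorter list, so either length is a bound. In particular,
    -- prepending n zeros to the other summand costs nothing.
    cost-addP-≤ˡ : (P Q : List (𝔽 p)) → cost M (addP P Q) ≤ length P
    cost-addP-≤ˡ []      Q       = z≤n
    cost-addP-≤ˡ (a ∷ P) []      = z≤n
    cost-addP-≤ˡ (a ∷ P) (b ∷ Q) = s≤s (cost-return-≤ (addP P Q) (_ ∷_) (cost-addP-≤ˡ P Q))

    cost-addP-≤ʳ : (P Q : List (𝔽 p)) → cost M (addP P Q) ≤ length Q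
    cost-addP-≤ʳ []      Q       = z≤n
    cost-addP-≤ʳ (a ∷ P) []      = z≤n
    cost-addP-≤ʳ (a ∷ P) (b ∷ Q) = s≤s (cost-return-≤ (addP P Q) (_ ∷_) (cost-addP-≤ʳ P Q))

    length-take-≤ : ∀ n (P : List (𝔽 p)) → length (take n P) ≤ n
    length-take-≤ n P = ℕ.≤-trans (ℕ.≤-reflexive (length-take n P)) (ℕ.m⊓n≤m n _)

    cost-mulP : ∀ n (P Q : List (𝔽 p)) → cost M (mulP n P Q) ≤ 1 + M n
    cost-mulP n P Q = s≤s (ℕ.≤-reflexive (ℕ.+-identityʳ (M n)))

    length-mulP : ∀ n (P Q : List (𝔽 p)) → length (run (mulP n P Q)) ≤ suc n
    length-mulP n P Q = length-take-≤ (suc n) (toList (polyProduct n (pad 0ᶠ (suc n) P) (pad 0ᶠ (suc n) Q)))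

    cost-combineP : ∀ n (P Q S T : List (𝔽 p)) → cost M (combineP n P Q S T) ≤ combineCost M n
    cost-combineP n P Q S T = ℕ.≤-trans
      (ℕ.≤-reflexive (trans (cost->>= (mulP n P S) (λ U → mulP n Q T >>= λ V → addP U V))
        (cong (λ c → cost M (mulP n P S) + c) (cost->>= (mulP n Q T) (λ V → addP (run (mulP n P S)) V)))))
      (ℕ.+-mono-≤ (cost-mulP n P S) (ℕ.+-mono-≤ (cost-mulP n Q T)
        (ℕ.≤-trans (cost-addP-≤ˡ (run (mulP n P S)) (run (mulP n Q T))) (length-mulP n P S))))

    cost-mulM : ∀ n (Q P : Matrix (List (𝔽 p))) →
                cost M (mulM n Q P) ≤ combineCost M n + (combineCost M n + (combineCost M n + combineCost M n))
    cost-mulM n Q P =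
      cost->>=-≤ (combineP n (₁₁ Q) (₁₂ Q) (₁₁ P) (₂₁ P)) (cost-combineP n (₁₁ Q) (₁₂ Q) (₁₁ P) (₂₁ P)) λ a →
      cost->>=-≤ (combineP n (₁₁ Q) (₁₂ Q) (₁₂ P) (₂₂ P)) (cost-combineP n (₁₁ Q) (₁₂ Q) (₁₂ P) (₂₂ P)) λ b →
      cost->>=-≤ (combineP n (₂₁ Q) (₂₂ Q) (₁₁ P) (₂₁ P)) (cost-combineP n (₂₁ Q) (₂₂ Q) (₁₁ P) (₂₁ P)) λ c →
      cost-return-≤ (combineP n (₂₁ Q) (₂₂ Q) (₁₂ P) (₂₂ P)) (matrix a b c) (cost-combineP n (₂₁ Q) (₂₂ Q) (₁₂ P) (₂₂ P))

  module _ (M : ℕ → ℕ) where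

    cost-stepBasis : ∀ s₁ s₂ (as bs : List (𝔽 p)) → cost M (stepBasis s₁ s₂ as bs) ≤ 6
    cost-stepBasis s₁ s₂ as bs = s≤s (s≤s (s≤s (s≤s (branches (useFirst (does (headOr 0ᶠ as ≟ 0ᶠ)) (does (headOr 0ᶠ bs ≟ 0ᶠ)) s₁ s₂)))))
      where
      branches : (x : Bool) → cost M (if x then eliminate₁ 0ᶠ 1ᶠ (headOr 0ᶠ as) (headOr 0ᶠ bs) s₁ s₂
                                      else eliminate₂ 0ᶠ 1ᶠ (headOr 0ᶠ as) (headOr 0ᶠ bs) s₁ s₂) ≤ 2
      branches true  = ℕ.≤-refl
      branches false = ℕ.≤-refl

    cost-orderBasis : ∀ h k s₁ s₂ (as bs : List (𝔽 p)) → cost M (orderBasis h k s₁ s₂ as bs) ≤ basisCost M h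
    cost-orderBasis zero    zero    s₁ s₂ as bs = s≤s z≤n
    cost-orderBasis zero    (suc k) s₁ s₂ as bs = cost-stepBasis s₁ s₂ as bs
    cost-orderBasis (suc h) k       s₁ s₂ as bs with k ≤? 2 ℕ.^ h
    ... | yes _ = ℕ.≤-trans (cost-orderBasis h k s₁ s₂ as bs) (ℕ.m≤m+n _ _)
    ... | no  _ = cost->>=-≤ M (orderBasis h _ s₁ s₂ as bs) (cost-orderBasis h _ s₁ s₂ as bs) λ (P , t₁ , t₂) →
      cost->>=-≤ M (combineP _ (₁₁ P) (₁₂ P) as bs) (cost-combineP M _ (₁₁ P) (₁₂ P) as bs) λ as′ →
      cost->>=-≤ M (combineP _ (₂₁ P) (₂₂ P) as bs) (cost-combineP M _ (₂₁ P) (₂₂ P) as bs) λ bs′ →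
      cost->>=-≤ M (orderBasis h (k ∸ 2 ℕ.^ h) t₁ t₂ (drop (2 ℕ.^ h) as′) (drop (2 ℕ.^ h) bs′))
        (cost-orderBasis h (k ∸ 2 ℕ.^ h) t₁ t₂ (drop (2 ℕ.^ h) as′) (drop (2 ℕ.^ h) bs′)) λ (Q , r₁ , r₂) →
      cost-return-≤ M (mulM _ Q P) (_, (r₁ , r₂)) (cost-mulM M _ Q P)

    cost-solveFraction : ∀ ℓ n (z : 𝔽 p) as bs → cost M (solveFraction ℓ n z as bs) ≤ basisCost M ⌈log₂ ℓ ⌉ + suc ℓ
    cost-solveFraction ℓ n z as bs =
      cost->>=-≤ M (orderBasis ⌈log₂ ℓ ⌉ ℓ n 0 as bs) (cost-orderBasis ⌈log₂ ℓ ⌉ ℓ n 0 as bs) λ (P , _) →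
      cost-return-≤ M (addP (replicate n z ++ ₁₁ P) (take (suc ℓ) (₁₂ P))) (₁₁ P ,_)
        (ℕ.≤-trans (cost-addP-≤ʳ M (replicate n z ++ ₁₁ P) (take (suc ℓ) (₁₂ P))) (length-take-≤ M (suc ℓ) (₁₂ P)))

    cost-d-rfr : ∀ ℓ m (R : Vec (𝔽 p) ℓ) → cost M (d-rfr ℓ m R) ≤ algorithmCost M ℓ
    cost-d-rfr ℓ (+ n) R = s≤s (s≤s (s≤s
      (cost->>=-≤ M (addP (toList R) (replicate n 0ᶠ ++ -1ᶠ ∷ []))
        (ℕ.≤-trans (cost-addP-≤ˡ M (toList R) (replicate n 0ᶠ ++ -1ᶠ ∷ []))
          (ℕ.≤-trans (ℕ.≤-reflexive (length-toList R)) (ℕ.n≤1+n ℓ))) λ as →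
      cost-return-≤ M (solveFraction ℓ n 0ᶠ as (-1ᶠ ∷ [])) swap (cost-solveFraction ℓ n 0ᶠ as (-1ᶠ ∷ [])))))
    cost-d-rfr ℓ -[1+ n ] R = s≤s (s≤s (s≤s
      (cost->>=-≤ M (addP (-1ᶠ ∷ []) (replicate (suc n) 0ᶠ ++ toList R)) {λ as → solveFraction ℓ (suc n) 0ᶠ as (toList R)}
        (ℕ.≤-trans (cost-addP-≤ˡ M (-1ᶠ ∷ []) (replicate (suc n) 0ᶠ ++ toList R)) (s≤s (z≤n {ℓ}))) λ as →
      cost-solveFraction ℓ (suc n) 0ᶠ as (toList R))))

-- Correctness

module Coefficients {p : ℕ} .{{_ : NonZero p}} where

  open PowerSeries (𝔽-isCommutativeRing {p})
  open ≡-Reasoning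

  private
    module 𝔽 = CommutativeRing (𝔽-commutativeRing p)

  coeff-+ᴾ : (P Q : Poly p) → coeff (P +ᴾ Q) ≗ coeff P ⊕ coeff Q
  coeff-+ᴾ []      Q       i       = sym (𝔽.+-identityˡ (coeff Q i))
  coeff-+ᴾ (a ∷ P) []      i       = sym (𝔽.+-identityʳ (coeff (a ∷ P) i))
  coeff-+ᴾ (a ∷ P) (b ∷ Q) zero    = refl
  coeff-+ᴾ (a ∷ P) (b ∷ Q) (suc i) = coeff-+ᴾ P Q i

  coeff-map : (f : 𝔽 p → 𝔽 p) → f 0ᶠ ≡ 0ᶠ → (P : Poly p) → ∀ i → coeff (map f P) i ≡ f (coeff P i)
  coeff-map f f0≡0 []      i       = sym f0≡0
  coeff-map f f0≡0 (a ∷ P) zero    = refl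
  coeff-map f f0≡0 (a ∷ P) (suc i) = coeff-map f f0≡0 P i

  coeff-∷ : ∀ a (P : Poly p) → coeff (a ∷ P) ≗ a ◂ coeff P
  coeff-∷ a P zero    = refl
  coeff-∷ a P (suc i) = refl

  coeff-*ᴾ : (P Q : Poly p) → coeff (P *ᴾ Q) ≗ coeff P ⊛ coeff Q
  coeff-*ᴾ []      Q i = sym (⊛-zeroˡ (coeff Q) i)
  coeff-*ᴾ (a ∷ P) Q zero = begin
    coeff (map (a *ᶠ_) Q +ᴾ (0ᶠ ∷ P *ᴾ Q)) 0    ≡⟨ coeff-+ᴾ (map (a *ᶠ_) Q) (0ᶠ ∷ P *ᴾ Q) 0 ⟩
    coeff (map (a *ᶠ_) Q) 0 +ᶠ 0ᶠ               ≡⟨ 𝔽.+-identityʳ (coeff (map (a *ᶠ_) Q) 0) ⟩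
    coeff (map (a *ᶠ_) Q) 0                     ≡⟨ coeff-map (a *ᶠ_) (𝔽.zeroʳ a) Q 0 ⟩
    a *ᶠ coeff Q 0                              ∎
  coeff-*ᴾ (a ∷ P) Q (suc i) = begin
    coeff (map (a *ᶠ_) Q +ᴾ (0ᶠ ∷ P *ᴾ Q)) (suc i)
      ≡⟨ coeff-+ᴾ (map (a *ᶠ_) Q) (0ᶠ ∷ P *ᴾ Q) (suc i) ⟩
    coeff (map (a *ᶠ_) Q) (suc i) +ᶠ coeff (P *ᴾ Q) i
      ≡⟨ cong₂ _+ᶠ_ (coeff-map (a *ᶠ_) (𝔽.zeroʳ a) Q (suc i)) (coeff-*ᴾ P Q i) ⟩
    a *ᶠ coeff Q (suc i) +ᶠ (coeff P ⊛ coeff Q) i ∎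

  coeff-drop : ∀ k (P : Poly p) i → coeff (drop k P) i ≡ coeff P (k + i)
  coeff-drop zero    P       i = refl
  coeff-drop (suc k) []      i = refl
  coeff-drop (suc k) (a ∷ P) i = coeff-drop k P i

  coeff-take : ∀ n (P : Poly p) → coeff (take n P) ≈[ n ] coeff P
  coeff-take (suc n) []      _           = refl
  coeff-take (suc n) (a ∷ P) {zero}  _   = refl
  coeff-take (suc n) (a ∷ P) {suc i} i<n = coeff-take n P (s≤s⁻¹ i<n)

  deg<-take : ∀ n (P : Poly p) → (deg< n) (coeff (take n P))
  deg<-take zero    P       i       _   = refl
  deg<-take (suc n) []      i       _   = refl
  deg<-take (suc n) (a ∷ P) (suc i) n≤i = deg<-take n P i (s≤s⁻¹ n≤i)

  deg<-length : (P : Poly p) → (deg< length P) (coeff P)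
  deg<-length []      i       _   = refl
  deg<-length (a ∷ P) (suc i) l≤i = deg<-length P i (s≤s⁻¹ l≤i)

  coeff-pad : ∀ n (P : Poly p) → coeff (toList (pad 0ᶠ n P)) ≈[ n ] coeff P
  coeff-pad (suc n) []      {zero}  _   = refl
  coeff-pad (suc n) []      {suc i} i<n = coeff-pad n [] (s≤s⁻¹ i<n)
  coeff-pad (suc n) (a ∷ P) {zero}  _   = refl
  coeff-pad (suc n) (a ∷ P) {suc i} i<n = coeff-pad n P (s≤s⁻¹ i<n)

  coeff-tabulate : ∀ n (f : Series) → coeff (toList (tabulate {n = n} (f ∘ toℕ))) ≈[ n ] f
  coeff-tabulate (suc n) f {zero}  _   = refl
  coeff-tabulate (suc n) f {suc i} i<n = coeff-tabulate n (f ∘ suc) (s≤s⁻¹ i<n)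

  coeff-coefficients : ∀ n (P : Poly p) → (deg< n) (coeff P) → coeff (toList (coefficients n P)) ≗ coeff P
  coeff-coefficients n P P<n i with i ℕ.<? n
  ... | yes i<n = coeff-tabulate n (coeff P) i<n
  ... | no  i≮n = trans (deg<-length (toList (coefficients n P)) i
    (ℕ.≤-trans (ℕ.≤-reflexive (length-toList (coefficients n P))) (ℕ.≮⇒≥ i≮n))) (sym (P<n i (ℕ.≮⇒≥ i≮n)))

  coeff-replicate-++ : ∀ n (P : Poly p) → coeff (replicate n 0ᶠ ++ P) ≗ shift n (coeff P)
  coeff-replicate-++ zero    P i       = refl
  coeff-replicate-++ (suc n) P zero    = refl
  coeff-replicate-++ (suc n) P (suc i) = coeff-replicate-++ n P i

  coeff-applyUpTo : ∀ n f → (deg< n) f → coeff (applyUpTo f n) ≗ f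
  coeff-applyUpTo zero    f f<n i       = sym (f<n i z≤n)
  coeff-applyUpTo (suc n) f f<n zero    = refl
  coeff-applyUpTo (suc n) f f<n (suc i) = coeff-applyUpTo n (f ∘ suc) (λ j n≤j → f<n (suc j) (s≤s n≤j)) i

  all-0 : ∀ {P : Poly p} → All (_≡ 0ᶠ) P → coeff P ≗ 0ˢ
  all-0 []          i       = refl
  all-0 (a≡0 ∷ P≡0) zero    = a≡0
  all-0 (a≡0 ∷ P≡0) (suc i) = all-0 P≡0 i

  deg<-deg : (P : Poly p) → (deg< suc (deg P)) (coeff P)
  deg<-deg []      i       _ = refl
  deg<-deg (a ∷ P) (suc i) d<i with all? (_≟ 0ᶠ) P
  ... | yes P≡0 = all-0 P≡0 i
  ... | no  _   = deg<-deg P i (s≤s⁻¹ d<i)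

  coeff-1ᴾ : coeff 1ᴾ ≗ 1ˢ
  coeff-1ᴾ zero    = refl
  coeff-1ᴾ (suc i) = refl

  coeff-Z^ : ∀ n → coeff (Z ^ n) ≗ shift n 1ˢ
  coeff-Z^ zero    = coeff-1ᴾ
  coeff-Z^ (suc n) i = begin
    coeff (Z *ᴾ Z ^ n) i                    ≡⟨ coeff-*ᴾ Z (Z ^ n) i ⟩
    (coeff Z ⊛ coeff (Z ^ n)) i             ≡⟨ ⊛-cong {f′ = 0ᶠ ◂ 1ˢ} (S.trans (coeff-∷ 0ᶠ 1ᴾ) (◂-cong coeff-1ᴾ)) (coeff-Z^ n) i ⟩
    ((0ᶠ ◂ 1ˢ) ⊛ shift n 1ˢ) i              ≡⟨ 0◂-⊛ 1ˢ (shift n 1ˢ) i ⟩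
    (0ᶠ ◂ (1ˢ ⊛ shift n 1ˢ)) i              ≡⟨ ◂-cong (⊛-identityˡ (shift n 1ˢ)) i ⟩
    (0ᶠ ◂ shift n 1ˢ) i                     ∎

  [mod]⇒≈[] : ∀ {ℓ} (P Q : Poly p) → P ≈ Q [mod Z ^ ℓ ] → coeff P ≈[ ℓ ] coeff Q
  [mod]⇒≈[] {ℓ} P Q (S , SZ^ℓ≈P-Q) {i} i<ℓ = x-y≡0⇒x≡y (coeff P i) (coeff Q i) (begin
    coeff P i +ᶠ negᶠ (coeff Q i)        ≡⟨ cong (coeff P i +ᶠ_) (coeff-map negᶠ -0#≈0# Q i) ⟨
    coeff P i +ᶠ coeff (-ᴾ Q) i          ≡⟨ coeff-+ᴾ P (-ᴾ Q) i ⟨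
    coeff (P +ᴾ (-ᴾ Q)) i                ≡⟨ SZ^ℓ≈P-Q i ⟨
    coeff (S *ᴾ Z ^ ℓ) i                 ≡⟨ coeff-*ᴾ S (Z ^ ℓ) i ⟩
    (coeff S ⊛ coeff (Z ^ ℓ)) i          ≡⟨ ⊛-congˡ {coeff S} (coeff-Z^ ℓ) i ⟩
    (coeff S ⊛ shift ℓ 1ˢ) i             ≡⟨ ⊛-shift ℓ (coeff S) 1ˢ i ⟩
    shift ℓ (coeff S ⊛ 1ˢ) i             ≡⟨ shift-< ℓ (coeff S ⊛ 1ˢ) i<ℓ ⟩
    0ᶠ                                   ∎)
    where
    open Algebra.Properties.Ring 𝔽.ring using (-0#≈0#)
    open Algebra.Properties.Group 𝔽.+-group using () renaming (x∙y⁻¹≈ε⇒x≈y to x-y≡0⇒x≡y)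

  run-addP : (P Q : Poly p) → run (addP P Q) ≡ P +ᴾ Q
  run-addP []      Q       = refl
  run-addP (a ∷ P) []      = refl
  run-addP (a ∷ P) (b ∷ Q) = trans (run->>= (addP P Q) (λ S → return (a +ᶠ b ∷ S))) (cong (a +ᶠ b ∷_) (run-addP P Q))

  run-mulP : ∀ n (P Q : Poly p) → coeff (run (mulP n P Q)) ≈[ suc n ] coeff P ⊛ coeff Q
  run-mulP n P Q {i} i≤n = begin
    coeff (take (suc n) (toList (polyProduct n P′ Q′))) i  ≡⟨ coeff-take (suc n) (toList (polyProduct n P′ Q′)) i≤n ⟩
    coeff (toList (polyProduct n P′ Q′)) i                 ≡⟨ coeff-tabulate (suc (n + n)) (coeff (toList P′ *ᴾ toList Q′)) (ℕ.≤-trans i≤n (s≤s (ℕ.m≤m+n n n))) ⟩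
    coeff (toList P′ *ᴾ toList Q′) i                       ≡⟨ coeff-*ᴾ (toList P′) (toList Q′) i ⟩
    (coeff (toList P′) ⊛ coeff (toList Q′)) i              ≡⟨ ⊛-cong[] (coeff-pad (suc n) P) (coeff-pad (suc n) Q) i≤n ⟩
    (coeff P ⊛ coeff Q) i                                  ∎
    where
    P′ Q′ : Vec (𝔽 p) (suc n)
    P′ = pad 0ᶠ (suc n) P
    Q′ = pad 0ᶠ (suc n) Q

  deg<-mulP : ∀ n (P Q : Poly p) → (deg< suc n) (coeff (run (mulP n P Q)))
  deg<-mulP n P Q = deg<-take (suc n) (toList (polyProduct n (pad 0ᶠ (suc n) P) (pad 0ᶠ (suc n) Q)))

  coeff-combineP : ∀ n (P Q S T : Poly p) →
    coeff (run (combineP n P Q S T)) ≗ coeff (run (mulP n P S)) ⊕ coeff (run (mulP n Q T))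
  coeff-combineP n P Q S T i = trans (cong (λ R → coeff R i)
    (trans (run->>= (mulP n P S) (λ U → mulP n Q T >>= λ V → addP U V))
    (trans (run->>= (mulP n Q T) (λ V → addP (run (mulP n P S)) V))
           (run-addP (run (mulP n P S)) (run (mulP n Q T))))))
    (coeff-+ᴾ (run (mulP n P S)) (run (mulP n Q T)) i)

  run-combineP : ∀ n (P Q S T : Poly p) →
    coeff (run (combineP n P Q S T)) ≈[ suc n ] coeff P ⊛ coeff S ⊕ coeff Q ⊛ coeff T
  run-combineP n P Q S T i≤n = trans (coeff-combineP n P Q S T _)
    (cong₂ _+ᶠ_ (run-mulP n P S i≤n) (run-mulP n Q T i≤n))

  deg<-combineP : ∀ n (P Q S T : Poly p) → (deg< suc n) (coeff (run (combineP n P Q S T)))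
  deg<-combineP n P Q S T = deg<-≗ (S.sym (coeff-combineP n P Q S T))
    (deg<-⊕ (deg<-mulP n P S) (deg<-mulP n Q T))

module Correctness {p : ℕ} .{{_ : NonZero p}} (p-prime : Prime p) where

  open PowerSeries (𝔽-isCommutativeRing {p})
  open OrderBasis (𝔽-isCommutativeRing {p}) _≟_ (1≢0 p-prime) (∃-inverse p-prime)
  open Coefficients {p}
  open IsOrderBasis

  coeffᴹ : Matrix (Poly p) → Matrix Series
  coeffᴹ P = matrix (coeff (₁₁ P)) (coeff (₁₂ P)) (coeff (₂₁ P)) (coeff (₂₂ P))

  IsBasis : (a b : Series) (k s₁ s₂ : ℕ) → Basis (𝔽 p) → Set
  IsBasis a b k s₁ s₂ (P , t₁ , t₂) = IsOrderBasis a b k s₁ s₂ (coeffᴹ P) t₁ t₂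

  coeff-[_] : ∀ x → x ◂ 0ˢ ≗ coeff (x ∷ [])
  coeff-[ x ] zero    = refl
  coeff-[ x ] (suc i) = refl

  coeff-Z : Zˢ ≗ coeff (0ᶠ ∷ 1ᶠ ∷ [])
  coeff-Z zero          = refl
  coeff-Z (suc zero)    = refl
  coeff-Z (suc (suc i)) = refl

  headOr-0 : (P : Poly p) → headOr 0ᶠ P ≡ coeff P 0
  headOr-0 []      = refl
  headOr-0 (x ∷ P) = refl

  module _ {a b : Series} {s₁ s₂ : ℕ} where

    eliminate₁-correct : ∀ x y → a 0 ≡ x → b 0 ≡ y → x ≢ 0ᶠ → y ≡ 0ᶠ ⊎ s₁ ≤ s₂ →
                         IsBasis a b 1 s₁ s₂ (run (eliminate₁ 0ᶠ 1ᶠ x y s₁ s₂))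
    eliminate₁-correct x y a₀≡x b₀≡y x≢0 cond = isOrderBasis-≗
      ((coeff-Z , λ _ → refl) , (coeff-[ c ] , S.sym coeff-1ᴾ))
      (isOrderBasis-step₁ c (λ a₀≡0 → x≢0 (trans (sym a₀≡x) a₀≡0))
        (trans (cong₂ (λ u v → c *ᶠ u +ᶠ v) a₀≡x b₀≡y) (eliminator-eliminates y (*ᶠ-inverseʳ p-prime x x≢0)))
        (map₁ (eliminator-0 (invᶠ x)) cond))
      where
      c = eliminator y (invᶠ x)

    eliminate₂-correct : ∀ x y → a 0 ≡ x → b 0 ≡ y → y ≢ 0ᶠ → x ≡ 0ᶠ ⊎ s₂ < s₁ →
                         IsBasis a b 1 s₁ s₂ (run (eliminate₂ 0ᶠ 1ᶠ x y s₁ s₂))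
    eliminate₂-correct x y a₀≡x b₀≡y y≢0 cond = isOrderBasis-≗
      ((S.sym coeff-1ᴾ , coeff-[ c ]) , ((λ _ → refl) , coeff-Z))
      (isOrderBasis-step₂ c (λ b₀≡0 → y≢0 (trans (sym b₀≡y) b₀≡0))
        (trans (cong₂ (λ u v → u +ᶠ c *ᶠ v) a₀≡x b₀≡y)
          (trans (+ᶠ-comm x (c *ᶠ y)) (eliminator-eliminates x (*ᶠ-inverseʳ p-prime y y≢0))))
        (map₁ (eliminator-0 (invᶠ y)) cond))
      where
      c = eliminator x (invᶠ y)

    -- The two decisions are arguments, so that matching on them evaluates `useFirst`. Unimodularity
    -- excludes that both constant terms vanish.
    eliminate-correct : ∀ x y (x? : Dec (x ≡ 0ᶠ)) (y? : Dec (y ≡ 0ᶠ)) → a 0 ≡ x → b 0 ≡ y → Unimodular a b →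
      IsBasis a b 1 s₁ s₂ (run (if useFirst (does x?) (does y?) s₁ s₂
                                  then eliminate₁ 0ᶠ 1ᶠ x y s₁ s₂ else eliminate₂ 0ᶠ 1ᶠ x y s₁ s₂))
    eliminate-correct x y (yes x≡0) _ a₀≡x b₀≡y (inj₁ a₀≢0) = contradiction (trans a₀≡x x≡0) a₀≢0
    eliminate-correct x y (yes x≡0) _ a₀≡x b₀≡y (inj₂ b₀≢0) =
      eliminate₂-correct x y a₀≡x b₀≡y (λ y≡0 → b₀≢0 (trans b₀≡y y≡0)) (inj₁ x≡0)
    eliminate-correct x y (no x≢0) (yes y≡0) a₀≡x b₀≡y _ = eliminate₁-correct x y a₀≡x b₀≡y x≢0 (inj₁ y≡0)
    eliminate-correct x y (no x≢0) (no y≢0)  a₀≡x b₀≡y _ with s₁ ≤ᵇ s₂ in s₁≤ᵇs₂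
    ... | true  = eliminate₁-correct x y a₀≡x b₀≡y x≢0 (inj₂ (ℕ.≤ᵇ⇒≤ s₁ s₂ (subst T (sym s₁≤ᵇs₂) tt)))
    ... | false = eliminate₂-correct x y a₀≡x b₀≡y y≢0 (inj₂ (ℕ.≰⇒> λ s₁≤s₂ → subst T s₁≤ᵇs₂ (ℕ.≤⇒≤ᵇ s₁≤s₂)))

    stepBasis-correct : ∀ as bs → coeff as 0 ≡ a 0 → coeff bs 0 ≡ b 0 → Unimodular a b →
                        IsBasis a b 1 s₁ s₂ (run (stepBasis s₁ s₂ as bs))
    stepBasis-correct as bs as₀≡a₀ bs₀≡b₀ = eliminate-correct (headOr 0ᶠ as) (headOr 0ᶠ bs)
      (headOr 0ᶠ as ≟ 0ᶠ) (headOr 0ᶠ bs ≟ 0ᶠ)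
      (sym (trans (headOr-0 as) as₀≡a₀)) (sym (trans (headOr-0 bs) bs₀≡b₀))

  -- The program truncates at Z^(n+1), which loses nothing once the exact result is known to have
  -- degree at most n.
  combineP-≗ : ∀ n (P Q U V : Poly p) → (deg< suc n) (combine (coeff P) (coeff Q) (coeff U) (coeff V)) →
               combine (coeff P) (coeff Q) (coeff U) (coeff V) ≗ coeff (run (combineP n P Q U V))
  combineP-≗ n P Q U V small i with i ℕ.<? suc n
  ... | yes i≤n = sym (run-combineP n P Q U V i≤n)
  ... | no  i≰n = trans (small i (ℕ.≮⇒≥ i≰n)) (sym (deg<-combineP n P Q U V i (ℕ.≮⇒≥ i≰n)))

  module _ (n : ℕ) (Q P : Matrix (Poly p)) where

    private
      entry₁₁ entry₁₂ entry₂₁ entry₂₂ : Program (𝔽 p) (Poly p)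
      entry₁₁ = combineP n (₁₁ Q) (₁₂ Q) (₁₁ P) (₂₁ P)
      entry₁₂ = combineP n (₁₁ Q) (₁₂ Q) (₁₂ P) (₂₂ P)
      entry₂₁ = combineP n (₂₁ Q) (₂₂ Q) (₁₁ P) (₂₁ P)
      entry₂₂ = combineP n (₂₁ Q) (₂₂ Q) (₁₂ P) (₂₂ P)

    run-mulM : run (mulM n Q P) ≡ matrix (run entry₁₁) (run entry₁₂) (run entry₂₁) (run entry₂₂)
    run-mulM =
      trans (run->>= entry₁₁ (λ a → entry₁₂ >>= λ b → entry₂₁ >>= λ c → entry₂₂ >>= λ d → return (matrix a b c d)))
      (trans (run->>= entry₁₂ (λ b → entry₂₁ >>= λ c → entry₂₂ >>= λ d → return (matrix (run entry₁₁) b c d)))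
      (trans (run->>= entry₂₁ (λ c → entry₂₂ >>= λ d → return (matrix (run entry₁₁) (run entry₁₂) c d)))
             (run->>= entry₂₂ (λ d → return (matrix (run entry₁₁) (run entry₁₂) (run entry₂₁) d)))))

    mulM-≗ᴹ : Entries< (suc n) (coeffᴹ Q ⊠ coeffᴹ P) → coeffᴹ Q ⊠ coeffᴹ P ≗ᴹ coeffᴹ (run (mulM n Q P))
    mulM-≗ᴹ QP≤n = subst (λ M → coeffᴹ Q ⊠ coeffᴹ P ≗ᴹ coeffᴹ M) (sym run-mulM)
      ( (combineP-≗ n (₁₁ Q) (₁₂ Q) (₁₁ P) (₂₁ P) (Entries<.₁₁< QP≤n)
      , combineP-≗ n (₁₁ Q) (₁₂ Q) (₁₂ P) (₂₂ P) (Entries<.₁₂< QP≤n))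
      , (combineP-≗ n (₂₁ Q) (₂₂ Q) (₁₁ P) (₂₁ P) (Entries<.₂₁< QP≤n)
      , combineP-≗ n (₂₁ Q) (₂₂ Q) (₁₂ P) (₂₂ P) (Entries<.₂₂< QP≤n)))

  multiplyBases-correct : ∀ {a b k s₁ s₂} h B C → k ≤ 2 ℕ.^ suc h → IsOrderBasis a b k s₁ s₂
    (coeffᴹ (proj₁ C) ⊠ coeffᴹ (proj₁ B)) (proj₁ (proj₂ C)) (proj₂ (proj₂ C)) →
    IsBasis a b k s₁ s₂ (run (multiplyBases h B C))
  multiplyBases-correct {a} {b} {k} {s₁} {s₂} h (P , _) (Q , r₁ , r₂) k≤N basis =
    subst (IsBasis a b k s₁ s₂) (sym (run->>= (mulM (2 ℕ.^ suc h) Q P) (λ M → return (M , r₁ , r₂))))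
      (isOrderBasis-≗ (mulM-≗ᴹ (2 ℕ.^ suc h) Q P (entries<-mono (s≤s k≤N) (degrees basis))) basis)

  residual-≈ : ∀ {k l n f r} P Q as bs {a b} → coeff as ≈[ l ] a → coeff bs ≈[ l ] b →
    combine (coeff P) (coeff Q) a b ≗ shift k r → l ≤ suc n → k + f ≡ l →
    coeff (drop k (run (combineP n P Q as bs))) ≈[ f ] r
  residual-≈ {k} {l} {n} {f} {r} P Q as bs {a} {b} as≈a bs≈b order l≤n k+f≡l {i} i<f = begin
    coeff (drop k U) i                                             ≡⟨ coeff-drop k U i ⟩
    coeff U (k + i)                                                ≡⟨ run-combineP n P Q as bs (ℕ.≤-trans k+i<l l≤n) ⟩
    combine (coeff P) (coeff Q) (coeff as) (coeff bs) (k + i)      ≡⟨ cong₂ _+ᶠ_ (⊛-cong[] {f = coeff P} (λ _ → refl) as≈a k+i<l)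
                                                                                 (⊛-cong[] {f = coeff Q} (λ _ → refl) bs≈b k+i<l) ⟩
    combine (coeff P) (coeff Q) a b (k + i)                        ≡⟨ order (k + i) ⟩
    shift k r (k + i)                                              ≡⟨ shift-+ k r i ⟩
    r i                                                            ∎
    where
    open ≡-Reasoning
    U = run (combineP n P Q as bs)
    k+i<l : k + i < l
    k+i<l = subst (k + i <_) k+f≡l (ℕ.+-monoʳ-< k i<f)

  -- The lists need to agree with the true residuals modulo Z^k only. This weak hypothesis makes the
  -- induction go through, since the lists passed on by `glue` come from truncated products.
  orderBasis-correct : ∀ h k s₁ s₂ as bs {a b} → k ≤ 2 ℕ.^ h → coeff as ≈[ k ] a → coeff bs ≈[ k ] b →
    Unimodular a b → IsBasis a b k s₁ s₂ (run (orderBasis h k s₁ s₂ as bs))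

  glue-correct : ∀ h k {s₁ s₂} as bs {a b} B → 2 ℕ.^ h ≤ k → k ≤ 2 ℕ.^ suc h →
    coeff as ≈[ k ] a → coeff bs ≈[ k ] b →
    IsBasis a b (2 ℕ.^ h) s₁ s₂ B → IsBasis a b k s₁ s₂ (run (glue h k as bs B))

  orderBasis-correct zero zero s₁ s₂ as bs _ _ _ a⊥b =
    isOrderBasis-≗ ((S.sym coeff-1ᴾ , λ _ → refl) , ((λ _ → refl) , S.sym coeff-1ᴾ)) (isOrderBasis-0 a⊥b)
  orderBasis-correct zero (suc zero) s₁ s₂ as bs _ as≈a bs≈b a⊥b =
    stepBasis-correct as bs (as≈a (s≤s z≤n)) (bs≈b (s≤s z≤n)) a⊥b
  orderBasis-correct zero (suc (suc k)) s₁ s₂ as bs (s≤s ()) _ _ _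
  orderBasis-correct (suc h) k s₁ s₂ as bs {a} {b} k≤N as≈a bs≈b a⊥b with k ≤? 2 ℕ.^ h
  ... | yes k≤n = orderBasis-correct h k s₁ s₂ as bs k≤n as≈a bs≈b a⊥b
  ... | no  k≰n = subst (IsBasis a b k s₁ s₂) (sym (run->>= (orderBasis h (2 ℕ.^ h) s₁ s₂ as bs) (glue h k as bs)))
    (glue-correct h k as bs (run (orderBasis h (2 ℕ.^ h) s₁ s₂ as bs)) n≤k k≤N as≈a bs≈b
      (orderBasis-correct h (2 ℕ.^ h) s₁ s₂ as bs ℕ.≤-refl
        (λ i<n → as≈a (ℕ.≤-trans i<n n≤k)) (λ i<n → bs≈b (ℕ.≤-trans i<n n≤k)) a⊥b))
    where
    n≤k : 2 ℕ.^ h ≤ k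
    n≤k = ℕ.<⇒≤ (ℕ.≰⇒> k≰n)

  glue-correct h k {s₁} {s₂} as bs {a} {b} B@(P , t₁ , t₂) n≤k k≤N as≈a bs≈b basis =
    subst (IsBasis a b k s₁ s₂) (sym unfold)
      (multiplyBases-correct h B (run next) k≤N
        (subst (λ l → IsOrderBasis a b l s₁ s₂ (coeffᴹ (proj₁ (run next)) ⊠ coeffᴹ P) (proj₁ (proj₂ (run next))) (proj₂ (proj₂ (run next))))
          n+[k-n]≡k (isOrderBasis-⊠ basis next-correct)))
    where
    n N : ℕ
    n = 2 ℕ.^ h
    N = 2 ℕ.^ suc h
    first second : Program (𝔽 p) (Poly p)
    first  = combineP N (₁₁ P) (₁₂ P) as bs
    second = combineP N (₂₁ P) (₂₂ P) as bs
    next : Program (𝔽 p) (Basis (𝔽 p))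
    next = orderBasis h (k ∸ n) t₁ t₂ (drop n (run first)) (drop n (run second))
    n+[k-n]≡k : n + (k ∸ n) ≡ k
    n+[k-n]≡k = ℕ.m+[n∸m]≡n n≤k
    unfold : run (glue h k as bs B) ≡ run (multiplyBases h B (run next))
    unfold = trans (run->>= first (λ as′ → second >>= λ bs′ →
        orderBasis h (k ∸ n) t₁ t₂ (drop n as′) (drop n bs′) >>= multiplyBases h B))
      (trans (run->>= second (λ bs′ →
        orderBasis h (k ∸ n) t₁ t₂ (drop n (run first)) (drop n bs′) >>= multiplyBases h B))
      (run->>= next (multiplyBases h B)))
    k-n≤n : k ∸ n ≤ n
    k-n≤n = ℕ.m≤n+o⇒m∸n≤o k n (ℕ.≤-trans k≤N (ℕ.≤-reflexive (cong (n ℕ.+_) (ℕ.+-identityʳ n))))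
    next-correct : IsBasis (residual₁ basis) (residual₂ basis) (k ∸ n) t₁ t₂ (run next)
    next-correct = orderBasis-correct h (k ∸ n) t₁ t₂ (drop n (run first)) (drop n (run second)) k-n≤n
      (residual-≈ (₁₁ P) (₁₂ P) as bs as≈a bs≈b (order₁ basis) (ℕ.m≤n⇒m≤1+n k≤N) n+[k-n]≡k)
      (residual-≈ (₂₁ P) (₂₂ P) as bs as≈a bs≈b (order₂ basis) (ℕ.m≤n⇒m≤1+n k≤N) n+[k-n]≡k)
      (unimodular basis)

-- Asymptotic cost

-- Replacing n by ⌈n/2⌉ lowers the logarithm by one and loses at most a factor 2.
n≤2^⌈log₂n⌉ : ∀ n → n ≤ 2 ℕ.^ ⌈log₂ n ⌉
n≤2^⌈log₂n⌉ n = bound ⌈log₂ n ⌉ n ℕ.≤-refl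
  where
  bound : ∀ h n → ⌈log₂ n ⌉ ≤ h → n ≤ 2 ℕ.^ h
  bound h       0             _ = z≤n
  bound h       1             _ = ℕ.m^n>0 2 h
  bound zero    (suc (suc n)) log≤0 = contradiction (ℕ.≤-trans (⌈log₂⌉-mono-≤ {2} {2 + n} (s≤s (s≤s z≤n))) log≤0) λ ()
  bound (suc h) n@(suc (suc _)) log≤1+h = begin
    n                      ≡⟨ ℕ.⌊n/2⌋+⌈n/2⌉≡n n ⟨
    ⌊ n /2⌋ + ⌈ n /2⌉      ≤⟨ ℕ.+-monoˡ-≤ ⌈ n /2⌉ (ℕ.⌊n/2⌋≤⌈n/2⌉ n) ⟩
    ⌈ n /2⌉ + ⌈ n /2⌉      ≤⟨ ℕ.+-mono-≤ half≤ half≤ ⟩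
    2 ℕ.^ h + 2 ℕ.^ h      ≡⟨ cong (2 ℕ.^ h ℕ.+_) (ℕ.+-identityʳ _) ⟨
    2 ℕ.^ suc h            ∎
    where
    open ℕ.≤-Reasoning
    half≤ : ⌈ n /2⌉ ≤ 2 ℕ.^ h
    half≤ = bound h ⌈ n /2⌉ (ℕ.≤-trans (ℕ.≤-reflexive (⌈log₂⌈n/2⌉⌉≡⌈log₂n⌉∸1 n)) (ℕ.∸-monoˡ-≤ 1 log≤1+h))

-- If 2n were below 2^L with L = ⌈log₂ n⌉, taking logarithms would give L + 1 ≤ L.
2^⌈log₂n⌉≤2n : ∀ n .{{_ : NonZero n}} → 2 ℕ.^ ⌈log₂ n ⌉ ≤ 2 * n
2^⌈log₂n⌉≤2n n = ℕ.≮⇒≥ λ 2n<2^L → ℕ.<-irrefl refl (begin-strict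
  ⌈log₂ n ⌉                   <⟨ ℕ.n<1+n _ ⟩
  suc ⌈log₂ n ⌉               ≡⟨ ⌈log₂2*n⌉≡1+⌈log₂n⌉ n ⟨
  ⌈log₂ 2 * n ⌉               ≤⟨ ⌈log₂⌉-mono-≤ (ℕ.<⇒≤ 2n<2^L) ⟩
  ⌈log₂ 2 ℕ.^ ⌈log₂ n ⌉ ⌉     ≡⟨ ⌈log₂2^n⌉≡n ⌈log₂ n ⌉ ⟩
  ⌈log₂ n ⌉                   ∎)
  where open ℕ.≤-Reasoning

∃-bound-below : ∀ (M : ℕ → ℕ) n₀ → ∃ λ b → ∀ {n} → n < n₀ → M n ≤ b
∃-bound-below M zero    = 0 , λ ()
∃-bound-below M (suc n₀) with ∃-bound-below M n₀
... | b , M≤b = b + M n₀ , λ n<1+n₀ → case ℕ.m<1+n⇒m<n∨m≡n n<1+n₀ of λ where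
  (inj₁ n<n₀) → ℕ.≤-trans (M≤b n<n₀) (ℕ.m≤m+n b _)
  (inj₂ refl) → ℕ.m≤n+m _ b

-- The algorithm multiplies at sizes 2^h only, where the logarithm is h. The finitely many sizes
-- below n₀ are absorbed by the constant; for this the right side has to be positive at h = 0 too,
-- hence `suc h`.
∃-bound-2^ : ∀ {M} → M ∈O[ (λ n → n * ⌈log₂ n ⌉) ] → ∃ λ D → ∀ h → M (2 ℕ.^ h) ≤ D * (2 ℕ.^ h * suc h)
∃-bound-2^ {M} (c , n₀ , M≤) with ∃-bound-below M n₀
... | b , M≤b = c + b , λ h → bound h (n₀ ≤? 2 ℕ.^ h)
  where
  open ℕ.≤-Reasoning
  bound : ∀ h → Dec (n₀ ≤ 2 ℕ.^ h) → M (2 ℕ.^ h) ≤ (c + b) * (2 ℕ.^ h * suc h)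
  bound h (yes n₀≤2^h) = begin
    M (2 ℕ.^ h)                                ≤⟨ M≤ (2 ℕ.^ h) n₀≤2^h ⟩
    c * (2 ℕ.^ h * ⌈log₂ 2 ℕ.^ h ⌉)            ≡⟨ cong (λ l → c * (2 ℕ.^ h * l)) (⌈log₂2^n⌉≡n h) ⟩
    c * (2 ℕ.^ h * h)                          ≤⟨ ℕ.*-mono-≤ (ℕ.m≤m+n c b) (ℕ.*-monoʳ-≤ (2 ℕ.^ h) (ℕ.n≤1+n h)) ⟩
    (c + b) * (2 ℕ.^ h * suc h)                ∎
  bound h (no n₀≰2^h) = begin
    M (2 ℕ.^ h)                                ≤⟨ M≤b (ℕ.≰⇒> n₀≰2^h) ⟩
    b                                          ≤⟨ ℕ.m≤n+m b c ⟩
    c + b                                      ≡⟨ ℕ.*-identityʳ (c + b) ⟨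
    (c + b) * 1                                ≤⟨ ℕ.*-monoʳ-≤ (c + b) (ℕ.*-mono-≤ (ℕ.m^n>0 2 h) (s≤s (z≤n {h}))) ⟩
    (c + b) * (2 ℕ.^ h * suc h)                ∎

module _ (M : ℕ → ℕ) (D : ℕ) (M≤ : ∀ h → M (2 ℕ.^ h) ≤ D * (2 ℕ.^ h * suc h)) where

  open ℕ.≤-Reasoning
  open +-*-Solver

  -- With V = 2^h (h + 1), each of the two products costs at most (1 + D) V and the addition at most
  -- 2 V.
  combineCost-≤ : ∀ h → combineCost M (2 ℕ.^ h) ≤ (4 + 2 * D) * (2 ℕ.^ h * suc h)
  combineCost-≤ h = begin
    (1 + M N) + ((1 + M N) + suc N)                ≤⟨ ℕ.+-mono-≤ 1+M≤ (ℕ.+-mono-≤ 1+M≤ 1+N≤) ⟩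
    (V + D * V) + ((V + D * V) + (V + V))          ≡⟨ solve 2 (λ V D → (V :+ D :* V) :+ ((V :+ D :* V) :+ (V :+ V)) := (con 4 :+ con 2 :* D) :* V) refl V D ⟩
    (4 + 2 * D) * V                                ∎
    where
    N V : ℕ
    N = 2 ℕ.^ h
    V = N * suc h
    N≤V : N ≤ V
    N≤V = ℕ.m≤m*n N (suc h)
    1≤V : 1 ≤ V
    1≤V = ℕ.≤-trans (ℕ.m^n>0 2 h) N≤V
    1+M≤ : 1 + M N ≤ V + D * V
    1+M≤ = ℕ.+-mono-≤ 1≤V (M≤ h)
    1+N≤ : 1 + N ≤ V + V
    1+N≤ = ℕ.+-mono-≤ 1≤V N≤V

  -- The work on level h of the recursion tree is O(2^h h), and (h + 2)² − (h + 1)² ≥ h + 2.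
  basisCost-≤ : ∀ h → basisCost M h ≤ (6 * (4 + 2 * D)) * (2 ℕ.^ h * (suc h * suc h))
  basisCost-≤ zero = begin
    6                              ≤⟨ ℕ.*-monoʳ-≤ 6 (ℕ.m≤m+n 1 (3 + 2 * D)) ⟩
    6 * (4 + 2 * D)                ≡⟨ ℕ.*-identityʳ _ ⟨
    6 * (4 + 2 * D) * 1            ∎
  basisCost-≤ (suc h) = begin
    B + (c + (c + (B + (c + (c + (c + c))))))      ≤⟨ ℕ.+-mono-≤ B≤ (ℕ.+-mono-≤ c≤ (ℕ.+-mono-≤ c≤ (ℕ.+-mono-≤ B≤
                                                        (ℕ.+-mono-≤ c≤ (ℕ.+-mono-≤ c≤ (ℕ.+-mono-≤ c≤ c≤)))))) ⟩
    b + (d + (d + (b + (d + (d + (d + d))))))      ≤⟨ ℕ.m≤m+n _ _ ⟩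
    -- The slack added here turns the inequality into an identity, because (h + 2)² - (h + 1)² - (h
    -- + 2) = h + 1.
    b + (d + (d + (b + (d + (d + (d + d)))))) + 6 * E * (2 * N) * (1 + h)
      ≡⟨ solve 3 (λ E N h →
           let b = (con 6 :* E) :* (N :* ((con 1 :+ h) :* (con 1 :+ h)))
               d = E :* ((con 2 :* N) :* (con 2 :+ h))
           in b :+ (d :+ (d :+ (b :+ (d :+ (d :+ (d :+ d)))))) :+ con 6 :* E :* (con 2 :* N) :* (con 1 :+ h)
              := (con 6 :* E) :* ((con 2 :* N) :* ((con 2 :+ h) :* (con 2 :+ h)))) refl E N h ⟩
    (6 * E) * (2 ℕ.^ suc h * (suc (suc h) * suc (suc h)))  ∎
    where
    B c E N b d : ℕ
    B = basisCost M h
    c = combineCost M (2 ℕ.^ suc h)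
    E = 4 + 2 * D
    N = 2 ℕ.^ h
    b = (6 * E) * (N * (suc h * suc h))
    d = E * ((2 * N) * suc (suc h))
    B≤ : B ≤ b
    B≤ = basisCost-≤ h
    c≤ : c ≤ d
    c≤ = combineCost-≤ (suc h)

  algorithmCost-∈O : algorithmCost M ∈O[ (λ ℓ → ℓ * (⌈log₂ ℓ ⌉ * ⌈log₂ ℓ ⌉)) ]
  -- The 48 is 6 · 2 · 2²: 2^L ≤ 2ℓ contributes one factor 2 and L + 1 ≤ 2L two more. The linear
  -- terms satisfy 5 + 2ℓ ≤ 5ℓ. The threshold 2 ensures L ≥ 1; at ℓ = 1 the logarithm is 0.
  algorithmCost-∈O = 5 + 48 * E , 2 , bound
    where
    E : ℕ
    E = 4 + 2 * D
    bound : ∀ ℓ → 2 ≤ ℓ → algorithmCost M ℓ ≤ (5 + 48 * E) * (ℓ * (⌈log₂ ℓ ⌉ * ⌈log₂ ℓ ⌉))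
    bound ℓ 2≤ℓ = begin
      3 + ((1 + ℓ) + (basisCost M L + suc ℓ))
        ≡⟨ solve 2 (λ ℓ B → con 3 :+ ((con 1 :+ ℓ) :+ (B :+ (con 1 :+ ℓ))) := con 5 :+ con 2 :* ℓ :+ B) refl ℓ (basisCost M L) ⟩
      5 + 2 * ℓ + basisCost M L
        ≤⟨ ℕ.+-mono-≤ (ℕ.+-monoˡ-≤ (2 * ℓ) (ℕ.≤-trans (ℕ.n≤1+n 5) (ℕ.*-monoʳ-≤ 3 2≤ℓ))) (basisCost-≤ L) ⟩
      3 * ℓ + 2 * ℓ + 6 * E * (2 ℕ.^ L * (suc L * suc L))
        ≤⟨ ℕ.+-monoʳ-≤ (3 * ℓ + 2 * ℓ) (ℕ.*-monoʳ-≤ (6 * E)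
             (ℕ.*-mono-≤ (2^⌈log₂n⌉≤2n ℓ {{ℕ.>-nonZero (ℕ.≤-trans (s≤s z≤n) 2≤ℓ)}}) (ℕ.*-mono-≤ 1+L≤2L 1+L≤2L))) ⟩
      3 * ℓ + 2 * ℓ + 6 * E * (2 * ℓ * (2 * L * (2 * L)))
        ≤⟨ ℕ.+-monoˡ-≤ _ (ℕ.≤-trans (ℕ.≤-reflexive (solve 1 (λ ℓ → con 3 :* ℓ :+ con 2 :* ℓ := con 5 :* (ℓ :* con 1)) refl ℓ))
             (ℕ.*-monoʳ-≤ 5 (ℕ.*-monoʳ-≤ ℓ (ℕ.*-mono-≤ 1≤L 1≤L)))) ⟩
      5 * (ℓ * (L * L)) + 6 * E * (2 * ℓ * (2 * L * (2 * L)))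
        ≡⟨ solve 3 (λ ℓ L E → con 5 :* (ℓ :* (L :* L)) :+ con 6 :* E :* (con 2 :* ℓ :* (con 2 :* L :* (con 2 :* L)))
             := (con 5 :+ con 48 :* E) :* (ℓ :* (L :* L))) refl ℓ L E ⟩
      (5 + 48 * E) * (ℓ * (L * L)) ∎
      where
      L : ℕ
      L = ⌈log₂ ℓ ⌉
      1≤L : 1 ≤ L
      1≤L = ⌈log₂⌉-mono-≤ {2} {ℓ} 2≤ℓ
      1+L≤2L : 1 + L ≤ 2 * L
      1+L≤2L = ℕ.≤-trans (ℕ.+-monoˡ-≤ L 1≤L) (ℕ.≤-reflexive (cong (L ℕ.+_) (sym (ℕ.+-identityʳ L))))

-- Reconstruction

[+a]-[+b]≡+n⇒a≡n+b : ∀ a b n → + a ℤ.- + b ≡ + n → a ≡ n + b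
[+a]-[+b]≡+n⇒a≡n+b a b n a-b≡n = ℤ.+-injective (begin
  + a                      ≡⟨ ℤ.+-identityʳ (+ a) ⟨
  + a ℤ.+ + 0              ≡⟨ cong (λ i → + a ℤ.+ i) (ℤ.+-inverseˡ (+ b)) ⟨
  + a ℤ.+ (- + b ℤ.+ + b)  ≡⟨ ℤ.+-assoc (+ a) (- + b) (+ b) ⟨
  + a ℤ.- + b ℤ.+ + b      ≡⟨ cong (λ i → i ℤ.+ + b) a-b≡n ⟩
  + (n + b)                ∎)
  where open ≡-Reasoning

[+a]-[+b]≡-n⇒b≡n+a : ∀ a b n → + a ℤ.- + b ≡ - + n → b ≡ n + a
[+a]-[+b]≡-n⇒b≡n+a a b n a-b≡-n = [+a]-[+b]≡+n⇒a≡n+b b a n (begin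
  + b ℤ.- + a          ≡⟨ ℤ.+-comm (+ b) (- + a) ⟩
  - + a ℤ.+ + b        ≡⟨ cong (λ i → - + a ℤ.+ i) (ℤ.neg-involutive (+ b)) ⟨
  - + a ℤ.+ - - + b    ≡⟨ ℤ.neg-distrib-+ (+ a) (- + b) ⟨
  - (+ a ℤ.- + b)      ≡⟨ cong -_ a-b≡-n ⟩
  - - + n              ≡⟨ ℤ.neg-involutive (+ n) ⟩
  + n                  ∎)
  where open ≡-Reasoning

module Reconstruction {p : ℕ} .{{_ : NonZero p}} (p-prime : Prime p) where

  open PowerSeries (𝔽-isCommutativeRing {p})
  open OrderBasis (𝔽-isCommutativeRing {p}) _≟_ (1≢0 p-prime) (∃-inverse p-prime)
  open Coefficients {p}
  open Correctness p-prime
  open IsOrderBasis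
  open ≡-Reasoning

  -- Finiteness allows the divisor and its cofactors to be cut off at their degree bounds and read
  -- as coefficient lists.
  coprime⇒coprimeˢ : ∀ {F G : Poly p} → Coprime F G → Coprimeˢ (coeff F) (coeff G)
  coprime⇒coprimeˢ {F} {G} F⊥G q (d , q<d) x y (dx , x<) (dy , y<) xq≗F yq≗G
    with F⊥G {Q} (U , product U (coeff-applyUpTo dx x x<) xq≗F) (V , product V (coeff-applyUpTo dy y y<) yq≗G)
    where
    Q U V : Poly p
    Q = applyUpTo q d
    U = applyUpTo x dx
    V = applyUpTo y dy
    product : ∀ W {w f} → coeff W ≗ w → w ⊛ q ≗ f → coeff (W *ᴾ Q) ≗ f
    product W W≗w wq≗f = S.trans (coeff-*ᴾ W Q) (S.trans (⊛-cong W≗w (coeff-applyUpTo d q q<d)) wq≗f)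
  ... | C , CQ≈1 = coeff C , (length C , deg<-length C) , λ i → begin
    (coeff C ⊛ q) i                          ≡⟨ ⊛-congˡ {coeff C} (coeff-applyUpTo d q q<d) i ⟨
    (coeff C ⊛ coeff (applyUpTo q d)) i      ≡⟨ coeff-*ᴾ C (applyUpTo q d) i ⟨
    coeff (C *ᴾ applyUpTo q d) i             ≡⟨ CQ≈1 i ⟩
    coeff 1ᴾ i                               ≡⟨ coeff-1ᴾ i ⟩
    1ˢ i                                     ∎

  coeff-run-addP : (P Q : Poly p) → coeff (run (addP P Q)) ≗ coeff P ⊕ coeff Q
  coeff-run-addP P Q i = trans (cong (λ S → coeff S i) (run-addP P Q)) (coeff-+ᴾ P Q i)

  solveFraction-correct : ∀ {ℓ n κ k l} as bs → Unimodular (coeff as) (coeff bs) →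
    IsReducedFraction n ℓ (coeff as) (coeff bs) κ k (l ⊖ shift n k) →
    coeff (proj₁ (run (solveFraction ℓ n 0ᶠ as bs))) ≗ k ×
    coeff (proj₂ (run (solveFraction ℓ n 0ᶠ as bs))) ≗ l
  solveFraction-correct {ℓ} {n} {κ} {k} {l} as bs as⊥bs target =
    subst (λ S → coeff (proj₁ S) ≗ k × coeff (proj₂ S) ≗ l) (sym unfold) (proj₁ solution , sum≗l)
    where
    basis : Program (𝔽 p) (Basis (𝔽 p))
    basis = orderBasis ⌈log₂ ℓ ⌉ ℓ n 0 as bs
    K H : Poly p
    K = ₁₁ (proj₁ (run basis))
    H = ₁₂ (proj₁ (run basis))
    sum : Program (𝔽 p) (Poly p)
    sum = addP (replicate n 0ᶠ ++ K) (take (suc ℓ) H)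
    unfold : run (solveFraction ℓ n 0ᶠ as bs) ≡ (K , run sum)
    unfold = trans
      (run->>= basis (λ (P , _) → addP (replicate n 0ᶠ ++ ₁₁ P) (take (suc ℓ) (₁₂ P)) >>= λ S → return (₁₁ P , S)))
      (run->>= sum (λ S → return (K , S)))
    correct : IsBasis (coeff as) (coeff bs) ℓ n 0 (run basis)
    correct = orderBasis-correct ⌈log₂ ℓ ⌉ ℓ n 0 as bs (n≤2^⌈log₂n⌉ ℓ) (λ _ → refl) (λ _ → refl) as⊥bs
    solution : coeff K ≗ k × coeff H ≗ l ⊖ shift n k
    solution = orderBasis-solves as⊥bs correct target
    take-H : coeff (take (suc ℓ) H) ≗ coeff H
    take-H i with i ℕ.<? suc ℓ
    ... | yes i≤ℓ = coeff-take (suc ℓ) H i≤ℓ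
    ... | no  i≰ℓ = trans (deg<-take (suc ℓ) H i (ℕ.≮⇒≥ i≰ℓ)) (sym (Entries<.₁₂< (degrees correct) i (ℕ.≮⇒≥ i≰ℓ)))
    sum≗l : coeff (run sum) ≗ l
    sum≗l i = begin
      coeff (run sum) i                                                ≡⟨ coeff-run-addP (replicate n 0ᶠ ++ K) (take (suc ℓ) H) i ⟩
      coeff (replicate n 0ᶠ ++ K) i +ᶠ coeff (take (suc ℓ) H) i        ≡⟨ cong₂ _+ᶠ_ (trans (coeff-replicate-++ n K i) (shift-cong n (proj₁ solution) i))
                                                                                      (trans (take-H i) (proj₂ solution i)) ⟩
      shift n k i +ᶠ (l i -ᶠ shift n k i)                              ≡⟨ +ᶠ-comm (shift n k i) (l i -ᶠ shift n k i) ⟩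
      l i -ᶠ shift n k i +ᶠ shift n k i                                ≡⟨ x-y+y≡x (l i) (shift n k i) ⟩
      l i                                                              ∎

  -1ᶠ≡neg1 : -1ᶠ ≡ negᶠ 1ᶠ
  -1ᶠ≡neg1 = +ᶠ-identityˡ (negᶠ 1ᶠ)

  module _ {ℓ : ℕ} {R : Poly p} {m : ℤ} {F G : Poly p} (F/G : IsReconstruction ℓ R m F G) where

    open IsReconstruction F/G

    R≈F/G : coeff (toList (coefficients ℓ R)) ⊛ coeff G ≈[ ℓ ] coeff F
    R≈F/G {i} i<ℓ = begin
      (coeff (toList (coefficients ℓ R)) ⊛ coeff G) i   ≡⟨ ⊛-congʳ (coeff-coefficients ℓ R (deg<-mono (proj₁ fraction) (deg<-deg R))) i ⟩
      (coeff R ⊛ coeff G) i                             ≡⟨ coeff-*ᴾ R G i ⟨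
      coeff (R *ᴾ G) i                                  ≡⟨ [mod]⇒≈[] (R *ᴾ G) F (proj₂ fraction) i<ℓ ⟩
      coeff F i                                         ∎

    coprimeˢ : Coprimeˢ (coeff F) (coeff G)
    coprimeˢ = coprime⇒coprimeˢ {F} {G} coprime

    F-monic : MonicAt (deg F) (coeff F)
    F-monic = monic-F , deg<-deg F

    G-monic : MonicAt (deg G) (coeff G)
    G-monic = monic-G , deg<-deg G

  d-rfr-correct : ∀ ℓ R m F G → IsReconstruction ℓ R m F G →
    proj₁ (run (d-rfr ℓ m (coefficients ℓ R))) ≈ F × proj₂ (run (d-rfr ℓ m (coefficients ℓ R))) ≈ G
  d-rfr-correct ℓ R (+ n) F G F/G =
    subst (λ S → coeff (proj₁ S) ≗ coeff F × coeff (proj₂ S) ≗ coeff G) (sym unfold)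
      (swap (solveFraction-correct as bs (inj₂ (-1≢0 -1ᶠ≡neg1)) target))
    where
    open IsReconstruction F/G
    Rs Zⁿ bs as : Poly p
    Rs = toList (coefficients ℓ R)
    bs = -1ᶠ ∷ []
    Zⁿ = replicate n 0ᶠ ++ bs
    as = run (addP Rs Zⁿ)
    unfold : run (d-rfr ℓ (+ n) (coefficients ℓ R)) ≡ swap (run (solveFraction ℓ n 0ᶠ as bs))
    unfold = trans (run->>= (addP Rs Zⁿ) (λ as → solveFraction ℓ n 0ᶠ as bs >>= λ S → return (swap S)))
                   (run->>= (solveFraction ℓ n 0ᶠ as bs) (λ S → return (swap S)))
    as≗ : coeff as ≗ coeff Rs ⊕ shift n (-1ᶠ ◂ 0ˢ)
    as≗ i = trans (coeff-run-addP Rs Zⁿ i) (cong (coeff Rs i +ᶠ_)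
      (trans (coeff-replicate-++ n bs i) (shift-cong n (S.sym coeff-[ -1ᶠ ]) i)))
    degF≡ : deg F ≡ deg G + n
    degF≡ = trans ([+a]-[+b]≡+n⇒a≡n+b (deg F) (deg G) n deg-diff) (ℕ.+-comm n (deg G))
    target : IsReducedFraction n ℓ (coeff as) (coeff bs) (deg G) (coeff G) (coeff F ⊖ shift n (coeff G))
    target = isReducedFraction-⊖ (G-monic F/G) (subst (λ d → MonicAt d (coeff F)) degF≡ (F-monic F/G))
      (ℕ.≤-trans (ℕ.≤-reflexive (trans (ℕ.+-comm (deg G) _) (cong (_+ deg G) (sym degF≡)))) deg-sum)
      (coprimeˢ-sym {coeff F} {coeff G} (coprimeˢ F/G))
      λ {i} i<ℓ → trans (combine-congˡ (coeff G) (coeff F ⊖ shift n (coeff G)) as≗ (S.sym coeff-[ -1ᶠ ]) i)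
                        (order⁺ n {r = coeff Rs} {coeff F} {coeff G} -1ᶠ≡neg1 (R≈F/G F/G) i<ℓ)
  d-rfr-correct ℓ R -[1+ n-1 ] F G F/G =
    subst (λ S → coeff (proj₁ S) ≗ coeff F × coeff (proj₂ S) ≗ coeff G) (sym unfold)
      (solveFraction-correct as Rs (inj₁ as₀≢0) target)
    where
    open IsReconstruction F/G
    n : ℕ
    n = suc n-1
    Rs ZⁿR as : Poly p
    Rs = toList (coefficients ℓ R)
    ZⁿR = replicate n 0ᶠ ++ Rs
    as = run (addP (-1ᶠ ∷ []) ZⁿR)
    unfold : run (d-rfr ℓ -[1+ n-1 ] (coefficients ℓ R)) ≡ run (solveFraction ℓ n 0ᶠ as Rs)
    unfold = run->>= (addP (-1ᶠ ∷ []) ZⁿR) (λ as → solveFraction ℓ n 0ᶠ as Rs)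
    as≗ : coeff as ≗ (-1ᶠ ◂ 0ˢ) ⊕ shift n (coeff Rs)
    as≗ i = trans (coeff-run-addP (-1ᶠ ∷ []) ZⁿR i)
      (cong₂ _+ᶠ_ (sym (coeff-[ -1ᶠ ] i)) (coeff-replicate-++ n Rs i))
    -- Since n ≥ 1, Z^n R does not reach the constant term, which is therefore -1. The case m = 0
    -- belongs to the other branch, where b = -1.
    as₀≢0 : coeff as 0 ≢ 0ᶠ
    as₀≢0 as₀≡0 = -1≢0 -1ᶠ≡neg1 (trans (sym (trans (+ᶠ-comm -1ᶠ 0ᶠ) (+ᶠ-identityˡ -1ᶠ))) (trans (sym (as≗ 0)) as₀≡0))
    degG≡ : deg G ≡ deg F + n
    degG≡ = trans ([+a]-[+b]≡-n⇒b≡n+a (deg F) (deg G) n deg-diff) (ℕ.+-comm n (deg F))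
    target : IsReducedFraction n ℓ (coeff as) (coeff Rs) (deg F) (coeff F) (coeff G ⊖ shift n (coeff F))
    target = isReducedFraction-⊖ (F-monic F/G) (subst (λ d → MonicAt d (coeff G)) degG≡ (G-monic F/G))
      (ℕ.≤-trans (ℕ.≤-reflexive (cong (λ d → deg F + d) (sym degG≡))) deg-sum)
      (coprimeˢ F/G)
      λ {i} i<ℓ → trans (combine-congˡ (coeff F) (coeff G ⊖ shift n (coeff F)) as≗ (λ _ → refl) i)
                        (order⁻ n {r = coeff Rs} {coeff F} {coeff G} -1ᶠ≡neg1 (R≈F/G F/G) i<ℓ)

theorem4 : (∀ (p : ℕ) .{{_ : NonZero p}} → Prime p →
    ∀ (ℓ : ℕ) → 1 ≤ ℓ →
    ∀ (R : Poly p) → deg R < ℓ →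
    ∀ (m : ℤ) → - (+ ℓ) ≤ᶻ m → m ≤ᶻ + ℓ →
    ∀ (F G F′ G′ : Poly p) →
    IsReconstruction ℓ R m F G → IsReconstruction ℓ R m F′ G′ →
    F ≈ F′ × G ≈ G′)
    ×
    (Σ[ D-RFR ∈ Algorithm ]
    ∀ (M : ℕ → ℕ) → M ∈O[ (λ n → n * ⌈log₂ n ⌉) ] →
    Σ[ T ∈ (ℕ → ℕ) ]
    T ∈O[ (λ ℓ → ℓ * (⌈log₂ ℓ ⌉ * ⌈log₂ ℓ ⌉)) ] ×
    (∀ (p : ℕ) .{{_ : NonZero p}} → Prime p →
    ∀ (ℓ : ℕ) → 1 ≤ ℓ →
    ∀ (R : Poly p) → deg R < ℓ →
    ∀ (m : ℤ) → - (+ ℓ) ≤ᶻ m → m ≤ᶻ + ℓ →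
    ∀ (F G : Poly p) →
    IsReconstruction ℓ R m F G →
    proj₁ (run (D-RFR ℓ m (coefficients ℓ R))) ≈ F ×
    proj₂ (run (D-RFR ℓ m (coefficients ℓ R))) ≈ G ×
    cost M (D-RFR ℓ m (coefficients ℓ R)) ≤ T ℓ))
theorem4 = unique , (λ {X} → d-rfr {X}) , λ M M∈O →
  let D , M≤ = ∃-bound-2^ M∈O in
  algorithmCost M , algorithmCost-∈O M D M≤ ,
  λ p p-prime ℓ _ R _ m _ _ F G F/G →
    let F≈ , G≈ = Reconstruction.d-rfr-correct p-prime ℓ R m F G F/G in
    F≈ , G≈ , cost-d-rfr M ℓ m (coefficients ℓ R)
  where
  unique : ∀ (p : ℕ) .{{_ : NonZero p}} → Prime p → ∀ (ℓ : ℕ) → 1 ≤ ℓ → ∀ (R : Poly p) → deg R < ℓ →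
    ∀ (m : ℤ) → - (+ ℓ) ≤ᶻ m → m ≤ᶻ + ℓ → ∀ (F G F′ G′ : Poly p) →
    IsReconstruction ℓ R m F G → IsReconstruction ℓ R m F′ G′ → F ≈ F′ × G ≈ G′
  unique p p-prime ℓ _ R _ m _ _ F G F′ G′ F/G F′/G′ =
    let F≈ , G≈   = Reconstruction.d-rfr-correct p-prime ℓ R m F G F/G
        F′≈ , G′≈ = Reconstruction.d-rfr-correct p-prime ℓ R m F′ G′ F′/G′
    in (λ i → trans (sym (F≈ i)) (F′≈ i)) , (λ i → trans (sym (G≈ i)) (G′≈ i))
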